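{- Let $q$ be a prime power. If there exists a $2$-$(7,3,1)_q$ subspace design, then there exists a $2$-$(7,3,q^4)_q$ subspace design.
   Context: For a prime power $q$ and an $\mathbb{F}_q$-vector space $V$ of dimension $v$, a $t$-$(v,k,\lambda)_q$ subspace design is a set $D$ of $k$-dimensional subspaces (blocks) of $V$ such that each $t$-dimensional subspace of $V$ is contained in exactly $\lambda$ blocks of $D$ (in particular, blocks are not repeated). -}

module Defs where

open import Data.Nat using (ℕ; zero; suc; _^_)
open import Data.Nat.Primality using (Prime)
open import Data.Fin using (Fin)
import Data.Fin as Fin
open import Data.Vec using (Vec; []; _∷_; zipWith; map; replicate)
open import Data.List using (List; []; _∷_; concatMap; _++_)
import Data.List as L
open import Data.Bool using (Bool; true; false; not; _∨_; _∧_)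
open import Data.Product using (Σ; ∃; _×_; _,_)
open import Data.Empty using (⊥)
open import Relation.Nullary using (¬_)
open import Relation.Binary.PropositionalEquality using (_≡_; _≢_)
open import Algebra.Structures using (IsCommutativeRing)

IsPrimePower : ℕ → Set
IsPrimePower q = Σ ℕ λ p → Σ ℕ λ k → Prime p × q ≡ p ^ suc k

record FiniteField (q : ℕ) : Set where
  field
    _+_ _*_ : Fin q → Fin q → Fin q
    -_      : Fin q → Fin q
    0# 1#   : Fin q
    isCommutativeRing : IsCommutativeRing _≡_ _+_ _*_ -_ 0# 1#
    0≢1     : 0# ≢ 1#
    inverse : ∀ x → x ≢ 0# → Σ (Fin q) λ y → x * y ≡ 1#

module _ {q : ℕ} (F : FiniteField q) where
  open FiniteField F

  Vector : ℕ → Set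
  Vector n = Vec (Fin q) n

  zeroV : ∀ {n} → Vector n
  zeroV = replicate _ 0#

  _⊕_ : ∀ {n} → Vector n → Vector n → Vector n
  _⊕_ = zipWith _+_

  _⊙_ : ∀ {n} → Fin q → Vector n → Vector n
  c ⊙ v = map (c *_) v

  linComb : ∀ {n} k → (Fin k → Fin q) → (Fin k → Vector n) → Vector n
  linComb zero    c b = zeroV
  linComb (suc k) c b = (c Fin.zero ⊙ b Fin.zero) ⊕ linComb k (λ i → c (Fin.suc i)) (λ i → b (Fin.suc i))

  LinearlyIndependent : ∀ {n k} → (Fin k → Vector n) → Set
  LinearlyIndependent {k = k} b = ∀ c → linComb k c b ≡ zeroV → ∀ i → c i ≡ 0#

  InSpan : ∀ {n k} → (Fin k → Vector n) → Vector n → Set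
  InSpan {k = k} b v = Σ (Fin k → Fin q) λ c → linComb k c b ≡ v

  Subset : ℕ → Set
  Subset n = Vector n → Bool

  IsSubspaceOfDim : ∀ {n} → ℕ → Subset n → Set
  IsSubspaceOfDim {n} k S = Σ (Fin k → Vector n) λ b →
    LinearlyIndependent b × (∀ v → (S v ≡ true → InSpan b v) × (InSpan b v → S v ≡ true))

allVectors : (q n : ℕ) → List (Vec (Fin q) n)
allVectors q zero    = [] ∷ []
allVectors q (suc n) = concatMap (λ x → L.map (x ∷_) (allVectors q n)) (L.allFin q)

allᵇ : ∀ {A : Set} → (A → Bool) → List A → Bool
allᵇ p []       = true
allᵇ p (x ∷ xs) = p x ∧ allᵇ p xs

_⊆ᵇ_ : ∀ {q n} → (Vec (Fin q) n → Bool) → (Vec (Fin q) n → Bool) → Bool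
_⊆ᵇ_ {q} {n} S T = allᵇ (λ v → not (S v) ∨ T v) (allVectors q n)

countFin : (b : ℕ) → (Fin b → Bool) → ℕ
countFin zero    P = 0
countFin (suc b) P with P Fin.zero
... | true  = suc (countFin b (λ i → P (Fin.suc i)))
... | false = countFin b (λ i → P (Fin.suc i))

record SubspaceDesign {q : ℕ} (F : FiniteField q) (t v k λ' : ℕ) : Set where
  field
    numBlocks : ℕ
    block     : Fin numBlocks → Subset F v
    blockDim  : ∀ i → IsSubspaceOfDim F k (block i)
    distinct  : ∀ i j → i ≢ j → ¬ (∀ x → block i x ≡ block j x)
    balanced  : ∀ (T : Subset F v) → IsSubspaceOfDim F t T →
                countFin numBlocks (λ i → T ⊆ᵇ block i) ≡ λ'

{-# OPTIONS --safe #-}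
-- The new blocks are the 3-dimensional subspaces K such that K^⊥ contains no block of the given
-- 2-(7,3,1) design.  Let T have dimension 2.  The blocks meet T^⊥ in q, q² or q³ vectors, and
-- the first two moments of these sizes are determined by the design, so exactly q² + 1 blocks
-- lie in T^⊥.  Two blocks in a common 4-dimensional space would share a 2-dimensional subspace;
-- hence for x ∉ T at most one block is orthogonal to ⟨T , x⟩, and exactly (q² + 1)(q⁴ − q²)
-- vectors x ∉ T admit one.  The other q⁷ − q² − (q² + 1)(q⁴ − q²) = q⁴(q³ − q²) vectors outside T
-- lie in new blocks through T, each of which contains q³ − q² of them.
-- Dimensions enter only through the cardinalities of subspaces.
module Submission where

open import Defs
open import Data.Nat using (ℕ; zero; suc; _+_; _*_; _^_; _≤_; _<_; z≤n; s≤s; >-nonZero)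
open import Data.Nat.Properties hiding (_≟_)
open import Data.Nat.Solver using (module +-*-Solver)
open import Data.Bool using (Bool; true; false; not; _∧_; _∨_; if_then_else_)
open import Data.Bool.ListAction using (any)
import Data.Bool.Properties as Boolₚ
open import Data.Fin using (Fin)
import Data.Fin as Fin
import Data.Fin.Properties as Finₚ
open import Data.List using (List; []; _∷_; _++_; concatMap; length; lookup; tabulate; allFin; filter; cartesianProduct)
import Data.List as L
open import Data.List.Membership.Propositional using (_∈_)
import Data.List.Membership.Propositional.Properties as ∈ₚ
open import Data.List.Relation.Unary.Any using (here; there)
open import Data.List.Relation.Unary.All using (All; []; _∷_)
import Data.List.Relation.Unary.All as All
import Data.List.Relation.Unary.All.Properties as Allₚ
open import Data.Vec using (Vec; []; _∷_)
import Data.Vec as Vec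
import Data.Vec.Properties as Vecₚ
import Data.Vec.Functional as VF
open import Data.Product using (∃; _×_; _,_; proj₁; proj₂)
open import Data.Sum using (_⊎_; inj₁; inj₂)
open import Data.Empty using (⊥-elim)
open import Function using (_∘_; id)
open import Relation.Nullary using (¬_; Dec; yes; no; does)
open import Relation.Nullary.Decidable using (dec-true)
open import Relation.Binary.Definitions using (DecidableEquality)
open import Relation.Binary.PropositionalEquality hiding (J)
open import Algebra.Bundles using (CommutativeRing)
import Algebra.Properties.Ring as RingProperties

-- Behind the final number: T lies in q⁴ + q³ + q² + q + 1 subspaces K of dimension 3. For a block B
-- in T^⊥ the 4-dimensional space B^⊥ contains T and hence q + 1 such K, which are exactly those
-- excluded by B. No K is excluded twice, because a 2-dimensional subspace common to two blocks
-- contradicts λ = 1. So (q² + 1)(q + 1) are lost and q⁴ remain. The number q² + 1 is forced since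
-- the section sizes take only three values, while the number of blocks and two moments give three
-- linear equations for their multiplicities. Subspaces are Boolean functions on vectors, so they
-- come neither listed nor with a decidable equality, whereas vectors can be enumerated. Therefore
-- subspaces are counted through the vectors they contain, and duality appears as the product
-- formula for the sizes of U and U^⊥. Counts stay in the natural numbers: an equation involving a
-- difference is written with the subtracted term on the other side.

private variable
  A A′ : Set

-- Booleans, indicators and finite sums

true≢false : true ≢ false
true≢false ()

true-or-false : ∀ b → b ≡ true ⊎ b ≡ false
true-or-false true  = inj₁ refl
true-or-false false = inj₂ refl

not-true⇒false : ∀ {b} → ¬ (b ≡ true) → b ≡ false
not-true⇒false {true}  h = ⊥-elim (h refl)
not-true⇒false {false} h = refl

Bool-ext : ∀ {a b} → (a ≡ true → b ≡ true) → (b ≡ true → a ≡ true) → a ≡ b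
Bool-ext {true}  {b}     f g = sym (f refl)
Bool-ext {false} {true}  f g = g refl
Bool-ext {false} {false} f g = refl

∧-intro : ∀ {a b} → a ≡ true → b ≡ true → a ∧ b ≡ true
∧-intro refl refl = refl

∧-elimˡ : ∀ {a b} → a ∧ b ≡ true → a ≡ true
∧-elimˡ {true} _ = refl

∧-elimʳ : ∀ {a b} → a ∧ b ≡ true → b ≡ true
∧-elimʳ {true} h = h

dec-true⁻¹ : {P : Set} (p? : Dec P) → does p? ≡ true → P
dec-true⁻¹ (yes p) _ = p

χ : Bool → ℕ
χ true  = 1
χ false = 0

χ-∧ : ∀ a b → χ (a ∧ b) ≡ χ a * χ b
χ-∧ true  b = sym (+-identityʳ (χ b))
χ-∧ false b = refl

χ-mono : ∀ {a b} → (a ≡ true → b ≡ true) → χ a ≤ χ b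
χ-mono {true}  h rewrite h refl = ≤-refl
χ-mono {false} h = z≤n

∑ : List A → (A → ℕ) → ℕ
∑ []       f = 0
∑ (x ∷ xs) f = f x + ∑ xs f

∑-cong : ∀ (xs : List A) {f g : A → ℕ} → (∀ x → f x ≡ g x) → ∑ xs f ≡ ∑ xs g
∑-cong []       h = refl
∑-cong (x ∷ xs) h = cong₂ _+_ (h x) (∑-cong xs h)

∑-mono : ∀ (xs : List A) {f g : A → ℕ} → (∀ x → f x ≤ g x) → ∑ xs f ≤ ∑ xs g
∑-mono []       h = z≤n
∑-mono (x ∷ xs) h = +-mono-≤ (h x) (∑-mono xs h)

∑-zero : ∀ (xs : List A) → ∑ xs (λ _ → 0) ≡ 0
∑-zero []       = refl
∑-zero (x ∷ xs) = ∑-zero xs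

∑-+ : ∀ (xs : List A) (f g : A → ℕ) → ∑ xs (λ x → f x + g x) ≡ ∑ xs f + ∑ xs g
∑-+ []       f g = refl
∑-+ (x ∷ xs) f g = trans (cong (f x + g x +_) (∑-+ xs f g)) (shuffle (f x) (g x) (∑ xs f) (∑ xs g))
  where
  shuffle : ∀ a b c d → a + b + (c + d) ≡ a + c + (b + d)
  shuffle = solve 4 (λ a b c d → a :+ b :+ (c :+ d) := a :+ c :+ (b :+ d)) refl
    where open +-*-Solver

∑-*ˡ : ∀ (xs : List A) c (f : A → ℕ) → ∑ xs (λ x → c * f x) ≡ c * ∑ xs f
∑-*ˡ []       c f = sym (*-zeroʳ c)
∑-*ˡ (x ∷ xs) c f = trans (cong (c * f x +_) (∑-*ˡ xs c f)) (sym (*-distribˡ-+ c (f x) (∑ xs f)))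

∑-*ʳ : ∀ (xs : List A) c (f : A → ℕ) → ∑ xs (λ x → f x * c) ≡ ∑ xs f * c
∑-*ʳ xs c f = trans (∑-cong xs (λ x → *-comm (f x) c)) (trans (∑-*ˡ xs c f) (*-comm c (∑ xs f)))

∑-swap : ∀ (xs : List A) (ys : List A′) (f : A → A′ → ℕ) →
         ∑ xs (λ x → ∑ ys (f x)) ≡ ∑ ys (λ y → ∑ xs (λ x → f x y))
∑-swap []       ys f = sym (∑-zero ys)
∑-swap (x ∷ xs) ys f = trans (cong (∑ ys (f x) +_) (∑-swap xs ys f)) (sym (∑-+ ys (f x) _))

∑-++ : ∀ (xs ys : List A) (f : A → ℕ) → ∑ (xs ++ ys) f ≡ ∑ xs f + ∑ ys f
∑-++ []       ys f = refl
∑-++ (x ∷ xs) ys f = trans (cong (f x +_) (∑-++ xs ys f)) (sym (+-assoc (f x) _ _))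

∑-map : ∀ (g : A → A′) (xs : List A) (f : A′ → ℕ) → ∑ (L.map g xs) f ≡ ∑ xs (f ∘ g)
∑-map g []       f = refl
∑-map g (x ∷ xs) f = cong (f (g x) +_) (∑-map g xs f)

∑-concatMap : ∀ (g : A → List A′) (xs : List A) (f : A′ → ℕ) → ∑ (concatMap g xs) f ≡ ∑ xs (λ x → ∑ (g x) f)
∑-concatMap g []       f = refl
∑-concatMap g (x ∷ xs) f = trans (∑-++ (g x) (concatMap g xs) f) (cong (∑ (g x) f +_) (∑-concatMap g xs f))

-- Links `countFin`, in which the balance of a design is stated, to sums, in which all counting is
-- done.
∑-tabulate : ∀ {n} (g : Fin n → A) (P : A → Bool) → ∑ (tabulate g) (χ ∘ P) ≡ countFin n (P ∘ g)
∑-tabulate {n = zero}  g P = refl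
∑-tabulate {n = suc n} g P with P (g Fin.zero)
... | true  = cong suc (∑-tabulate (g ∘ Fin.suc) P)
... | false = ∑-tabulate (g ∘ Fin.suc) P

∑-lookup : ∀ (xs : List A) (P : A → Bool) → countFin (length xs) (P ∘ lookup xs) ≡ ∑ xs (χ ∘ P)
∑-lookup []       P = refl
∑-lookup (x ∷ xs) P with P x
... | true  = cong suc (∑-lookup xs P)
... | false = ∑-lookup xs P

∑-allFin-const : ∀ n c → ∑ (allFin n) (λ _ → c) ≡ n * c
∑-allFin-const n c = go {n} id
  where
  go : ∀ {m} {A : Set} (g : Fin m → A) → ∑ (tabulate g) (λ _ → c) ≡ m * c
  go {zero}  g = refl
  go {suc m} g = cong (c +_) (go (g ∘ Fin.suc))

-- Counting subsets of a finite type

record Finite (A : Set) : Set where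
  field
    elems : List A
    _≟_   : DecidableEquality A
    -- Completeness and absence of repetitions in one equation, already in the form in which it is
    -- substituted into sums.
    once  : ∀ x → ∑ elems (λ y → χ (does (y ≟ x))) ≡ 1

module Counting {A : Set} (fin : Finite A) where
  open Finite fin

  # : (A → Bool) → ℕ
  # P = ∑ elems (χ ∘ P)

  #-cong : ∀ {P Q : A → Bool} → (∀ x → P x ≡ Q x) → # P ≡ # Q
  #-cong h = ∑-cong elems (cong χ ∘ h)

  _==_ : A → A → Bool
  x == y = does (x ≟ y)

  ==-refl : ∀ x → x == x ≡ true
  ==-refl x = dec-true (x ≟ x) refl

  ==⇒≡ : ∀ {x y} → x == y ≡ true → x ≡ y
  ==⇒≡ {x} {y} = dec-true⁻¹ (x ≟ y)

  ≢⇒==false : ∀ {x y} → x ≢ y → x == y ≡ false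
  ≢⇒==false x≢y = not-true⇒false (x≢y ∘ ==⇒≡)

  ∑-point : ∀ x (f : A → ℕ) → ∑ elems (λ y → χ (y == x) * f y) ≡ f x
  ∑-point x f = begin
    ∑ elems (λ y → χ (y == x) * f y) ≡⟨ ∑-cong elems at-x ⟩
    ∑ elems (λ y → χ (y == x) * f x) ≡⟨ ∑-*ʳ elems (f x) _ ⟩
    ∑ elems (λ y → χ (y == x)) * f x ≡⟨ cong (_* f x) (once x) ⟩
    1 * f x                          ≡⟨ *-identityˡ (f x) ⟩
    f x                              ∎
    where
    open ≡-Reasoning
    at-x : ∀ y → χ (y == x) * f y ≡ χ (y == x) * f x
    at-x y with y ≟ x
    ... | yes refl = refl
    ... | no _     = refl

  -- Each `h (f x)` is spread over the points y by `∑-point`; after the exchange of sums every y is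
  -- hit exactly once, namely from `g y`.
  ∑-reindex : (f g : A → A) → (∀ x → g (f x) ≡ x) → (∀ x → f (g x) ≡ x) →
              ∀ h → ∑ elems (h ∘ f) ≡ ∑ elems h
  ∑-reindex f g gf fg h = begin
    ∑ elems (λ x → h (f x))                                   ≡⟨ ∑-cong elems (λ x → sym (∑-point (f x) h)) ⟩
    ∑ elems (λ x → ∑ elems (λ y → χ (y == f x) * h y))        ≡⟨ ∑-swap elems elems _ ⟩
    ∑ elems (λ y → ∑ elems (λ x → χ (y == f x) * h y))        ≡⟨ ∑-cong elems (λ y → ∑-*ʳ elems (h y) _) ⟩
    ∑ elems (λ y → ∑ elems (λ x → χ (y == f x)) * h y)        ≡⟨ ∑-cong elems (λ y → cong (_* h y) (preimage y)) ⟩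
    ∑ elems (λ y → 1 * h y)                                   ≡⟨ ∑-cong elems (λ y → *-identityˡ (h y)) ⟩
    ∑ elems h                                                 ∎
    where
    open ≡-Reasoning
    preimage : ∀ y → ∑ elems (λ x → χ (y == f x)) ≡ 1
    preimage y = trans (∑-cong elems (λ x → cong χ (Bool-ext
      (λ e → dec-true (x ≟ g y) (sym (trans (cong g (==⇒≡ e)) (gf x))))
      (λ e → dec-true (y ≟ f x) (sym (trans (cong f (==⇒≡ e)) (fg y))))))) (once (g y))

  #-mono : ∀ {P Q : A → Bool} → (∀ x → P x ≡ true → Q x ≡ true) → # P ≤ # Q
  #-mono h = ∑-mono elems (λ x → χ-mono (h x))

  #-singleton : ∀ {P : A → Bool} x → P x ≡ true → (∀ y → P y ≡ true → y ≡ x) → # P ≡ 1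
  #-singleton x Px uniq = trans (#-cong (λ y → Bool-ext (λ Py → dec-true (y ≟ x) (uniq y Py))
    (λ e → trans (cong _ (==⇒≡ e)) Px))) (once x)

  -- P together with the extra point x still fits pointwise below Q.
  #-strict : ∀ {P Q : A → Bool} → (∀ x → P x ≡ true → Q x ≡ true) →
             ∀ x → Q x ≡ true → P x ≡ false → # P < # Q
  #-strict {P} {Q} P⊆Q x Qx ¬Px = subst (_≤ # Q)
    (trans (∑-+ elems _ _) (cong (_+ # P) (once x)))
    (∑-mono elems pointwise)
    where
    pointwise : ∀ y → χ (y == x) + χ (P y) ≤ χ (Q y)
    pointwise y with y ≟ x
    ... | yes refl rewrite ¬Px | Qx = ≤-refl
    ... | no _ = χ-mono (P⊆Q y)

  -- Takes the place of the argument that nested subspaces of equal dimension coincide.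
  ⊆-antisym-# : ∀ {P Q : A → Bool} → (∀ x → P x ≡ true → Q x ≡ true) → # Q ≤ # P →
                ∀ x → Q x ≡ true → P x ≡ true
  ⊆-antisym-# {P} P⊆Q #Q≤#P x Qx with true-or-false (P x)
  ... | inj₁ Px  = Px
  ... | inj₂ ¬Px = ⊥-elim (<⇒≱ (#-strict P⊆Q x Qx ¬Px) #Q≤#P)

  #≤1⇒unique : ∀ {P : A → Bool} → # P ≤ 1 → ∀ x y → P x ≡ true → P y ≡ true → x ≡ y
  #≤1⇒unique {P} #P≤1 x y Px Py = sym (==⇒≡ (⊆-antisym-#
    (λ z e → subst (λ w → P w ≡ true) (sym (==⇒≡ e)) Px)
    (≤-trans #P≤1 (≤-reflexive (sym (once x)))) y Py))

  private
    allᵇ⇒occurs : ∀ p xs → allᵇ p xs ≡ true → ∀ x → 0 < ∑ xs (λ y → χ (y == x)) → p x ≡ true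
    allᵇ⇒occurs p (y ∷ ys) h x pos with y ≟ x
    ... | yes refl = ∧-elimˡ h
    ... | no _     = allᵇ⇒occurs p ys (∧-elimʳ {p y} h) x pos

    allᵇ⁺ : ∀ p (xs : List A) → (∀ x → p x ≡ true) → allᵇ p xs ≡ true
    allᵇ⁺ p []       h = refl
    allᵇ⁺ p (x ∷ xs) h = ∧-intro (h x) (allᵇ⁺ p xs h)

    allᵇ-false : ∀ p (xs : List A) → allᵇ p xs ≡ false → ∃ λ x → p x ≡ false
    allᵇ-false p (x ∷ xs) h with true-or-false (p x)
    ... | inj₂ ¬px = x , ¬px
    ... | inj₁ px rewrite px = allᵇ-false p xs h

  every : (A → Bool) → Bool
  every p = allᵇ p elems

  every⁻ : ∀ {p} → every p ≡ true → ∀ x → p x ≡ true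
  every⁻ {p} h x = allᵇ⇒occurs p elems h x (≤-reflexive (sym (once x)))

  every⁺ : ∀ {p} → (∀ x → p x ≡ true) → every p ≡ true
  every⁺ {p} = allᵇ⁺ p elems

  every-false : ∀ {p} → every p ≡ false → ∃ λ x → p x ≡ false
  every-false {p} = allᵇ-false p elems

  -- On vectors this unfolds to `_⊆ᵇ_`, so the counts in `balanced` are counts of this test by
  -- definition.
  _⊆_ : (A → Bool) → (A → Bool) → Bool
  P ⊆ Q = every (λ x → not (P x) ∨ Q x)

  ⊆⁻ : ∀ {P Q} → P ⊆ Q ≡ true → ∀ x → P x ≡ true → Q x ≡ true
  ⊆⁻ {P} {Q} h x Px with every⁻ {λ x → not (P x) ∨ Q x} h x
  ... | e rewrite Px = e

  ⊆⁺ : ∀ {P Q} → (∀ x → P x ≡ true → Q x ≡ true) → P ⊆ Q ≡ true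
  ⊆⁺ {P} {Q} h = every⁺ pointwise
    where
    pointwise : ∀ x → not (P x) ∨ Q x ≡ true
    pointwise x with P x in eq
    ... | true  = h x eq
    ... | false = refl

  ⊆-false : ∀ {P Q} → P ⊆ Q ≡ false → ∃ λ x → P x ≡ true × Q x ≡ false
  ⊆-false {P} {Q} h with every-false {λ x → not (P x) ∨ Q x} h
  ... | x , e with P x in eq
  ...   | true = x , eq , e

  -- Supplies vectors outside a given subspace by size alone, where a basis extension would
  -- otherwise be used.
  #<⇒∃ : ∀ {P Q} → # Q < # P → ∃ λ x → P x ≡ true × Q x ≡ false
  #<⇒∃ {P} {Q} lt with true-or-false (P ⊆ Q)
  ... | inj₁ h = ⊥-elim (<⇒≱ lt (#-mono (⊆⁻ {P} {Q} h)))
  ... | inj₂ h = ⊆-false {P} {Q} h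

finite-Fin : ∀ n → Finite (Fin n)
finite-Fin n = record { elems = allFin n ; _≟_ = Finₚ._≟_ ; once = λ x →
  trans (∑-tabulate id (λ y → does (y Finₚ.≟ x))) (count-≟ x) }
  where
  count-none : ∀ n → countFin n (λ _ → false) ≡ 0
  count-none zero    = refl
  count-none (suc n) = count-none n

  count-≟ : ∀ {n} (x : Fin n) → countFin n (λ y → does (y Finₚ.≟ x)) ≡ 1
  count-≟ {suc n} Fin.zero    = cong suc (count-none n)
  count-≟ {suc n} (Fin.suc x) = count-≟ x

∑-allVectors-suc : ∀ q n (f : Vec (Fin q) (suc n) → ℕ) →
  ∑ (allVectors q (suc n)) f ≡ ∑ (allFin q) (λ a → ∑ (allVectors q n) (λ v → f (a ∷ v)))
∑-allVectors-suc q n f = trans (∑-concatMap _ (allFin q) f)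
  (∑-cong (allFin q) (λ a → ∑-map (a ∷_) (allVectors q n) f))

finite-Vec : ∀ q n → Finite (Vec (Fin q) n)
finite-Vec q n = record { elems = allVectors q n ; _≟_ = Vecₚ.≡-dec Finₚ._≟_ ; once = once-Vec n }
  where
  _≟ᵥ_ : ∀ {n} → DecidableEquality (Vec (Fin q) n)
  _≟ᵥ_ = Vecₚ.≡-dec Finₚ._≟_

  ≟-∷ : ∀ {n} a b (u v : Vec (Fin q) n) →
        χ (does ((a ∷ u) ≟ᵥ (b ∷ v))) ≡ χ (does (a Finₚ.≟ b)) * χ (does (u ≟ᵥ v))
  ≟-∷ a b u v = χ-∧ (does (a Finₚ.≟ b)) (does (u ≟ᵥ v))

  once-Vec : ∀ n x → ∑ (allVectors q n) (λ y → χ (does (y ≟ᵥ x))) ≡ 1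
  once-Vec zero    []      = refl
  once-Vec (suc n) (b ∷ x) = begin
    ∑ (allVectors q (suc n)) (λ y → χ (does (y ≟ᵥ (b ∷ x))))
      ≡⟨ ∑-allVectors-suc q n _ ⟩
    ∑ (allFin q) (λ a → ∑ (allVectors q n) (λ v → χ (does ((a ∷ v) ≟ᵥ (b ∷ x)))))
      ≡⟨ ∑-cong (allFin q) (λ a → trans (∑-cong (allVectors q n) (λ v → ≟-∷ a b v x))
           (trans (∑-*ˡ (allVectors q n) (χ (does (a Finₚ.≟ b))) _) (cong (χ (does (a Finₚ.≟ b)) *_) (once-Vec n x)))) ⟩
    ∑ (allFin q) (λ a → χ (does (a Finₚ.≟ b)) * 1)
      ≡⟨ ∑-cong (allFin q) (λ a → *-identityʳ _) ⟩
    ∑ (allFin q) (λ a → χ (does (a Finₚ.≟ b)))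
      ≡⟨ Finite.once (finite-Fin q) b ⟩
    1 ∎
    where open ≡-Reasoning

∑-allVectors-const : ∀ q n c → ∑ (allVectors q n) (λ _ → c) ≡ q ^ n * c
∑-allVectors-const q zero    c = refl
∑-allVectors-const q (suc n) c = begin
  ∑ (allVectors q (suc n)) (λ _ → c)                    ≡⟨ ∑-allVectors-suc q n _ ⟩
  ∑ (allFin q) (λ _ → ∑ (allVectors q n) (λ _ → c))     ≡⟨ ∑-allFin-const q _ ⟩
  q * ∑ (allVectors q n) (λ _ → c)                      ≡⟨ cong (q *_) (∑-allVectors-const q n c) ⟩
  q * (q ^ n * c)                                       ≡⟨ sym (*-assoc q (q ^ n) c) ⟩
  q * q ^ n * c                                         ∎
  where open ≡-Reasoning

-- Solving the counting equations over the natural numbers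

-- The polynomial identities below are in p, with q = p + 2, so that no subtraction occurs.
solve-degree : ∀ q → 1 < q → ∀ {r} → q ^ 3 * r + q ≡ q * r + q ^ 7 → r ≡ q ^ 4 + q ^ 2 + 1
solve-degree (suc zero) (s≤s ())
solve-degree (suc (suc p)) _ {r} e = *-cancelˡ-≡ r _ (suc p * (2 + p) * (3 + p))
  (+-cancelʳ-≡ ((2 + p) * r + (2 + p)) _ _ (trans (sym (left p r)) (trans e (right p r))))
  where
  open +-*-Solver
  left : ∀ p r → let q = 2 + p in q ^ 3 * r + q ≡ suc p * q * suc q * r + (q * r + q)
  left = solve 2 (λ p r → let q = con 2 :+ p in
    q :^ 3 :* r :+ q := (con 1 :+ p) :* q :* (con 1 :+ q) :* r :+ (q :* r :+ q)) refl
  right : ∀ p r → let q = 2 + p in q * r + q ^ 7 ≡ suc p * q * suc q * (q ^ 4 + q ^ 2 + 1) + (q * r + q)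
  right = solve 2 (λ p r → let q = con 2 :+ p in
    q :* r :+ q :^ 7 := (con 1 :+ p) :* q :* (con 1 :+ q) :* (q :^ 4 :+ q :^ 2 :+ con 1) :+ (q :* r :+ q)) refl

private
  -- Closed forms, with `suc p` = q - 1. `r` is the number of blocks through a nonzero vector, `b₀`
  -- = [7]_q (q² - q + 1) the number of blocks, and `suc p * k` = q⁵ - 1 the number of nonzero
  -- vectors of T^⊥. `Y₀` and `Z₀` are the sums over all blocks of the size of the section with T^⊥
  -- and of its square.
  module Moments (p : ℕ) where
    q = 2 + p
    r = q ^ 4 + q ^ 2 + 1
    b₀ = (q ^ 6 + q ^ 5 + q ^ 4 + q ^ 3 + q ^ 2 + q + 1) * (q * suc p + 1)
    k = q ^ 4 + q ^ 3 + q ^ 2 + q + 1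
    Y₀ = b₀ + suc p * k * r
    Z₀ = Y₀ + suc p * k * (q * r + q * suc p * (q ^ 3 + q ^ 2 + q + 1))

    open +-*-Solver

    b-identity : ∀ b → q ^ 7 * r + b ≡ suc p * suc (q ^ 2 + q) * b₀ + (b + r)
    b-identity b = solve 2 (λ p b → let q = con 2 :+ p; r = q :^ 4 :+ q :^ 2 :+ con 1 in
      q :^ 7 :* r :+ b := (con 1 :+ p) :* (con 1 :+ (q :^ 2 :+ q)) :*
        ((q :^ 6 :+ q :^ 5 :+ q :^ 4 :+ q :^ 3 :+ q :^ 2 :+ q :+ con 1) :* (q :* (con 1 :+ p) :+ con 1)) :+ (b :+ r)) refl p b

    final : Z₀ + q ^ 3 * b₀ ≡ (q + q ^ 2) * Y₀ + (q ^ 2 + 1) * (q ^ 3 * (suc p * suc p) * suc q)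
    final = solve 1 (λ p → let
        q = con 2 :+ p
        r = q :^ 4 :+ q :^ 2 :+ con 1
        b₀ = (q :^ 6 :+ q :^ 5 :+ q :^ 4 :+ q :^ 3 :+ q :^ 2 :+ q :+ con 1) :* (q :* (con 1 :+ p) :+ con 1)
        k = q :^ 4 :+ q :^ 3 :+ q :^ 2 :+ q :+ con 1
        Y₀ = b₀ :+ (con 1 :+ p) :* k :* r
        Z₀ = Y₀ :+ (con 1 :+ p) :* k :* (q :* r :+ q :* (con 1 :+ p) :* (q :^ 3 :+ q :^ 2 :+ q :+ con 1))
      in Z₀ :+ q :^ 3 :* b₀ := (q :+ q :^ 2) :* Y₀ :+
         (q :^ 2 :+ con 1) :* (q :^ 3 :* ((con 1 :+ p) :* (con 1 :+ p)) :* (con 1 :+ q))) refl p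

-- With differences restored, the hypotheses read (q³ - 1) b = (q⁷ - 1) r, Y₁ = b + (q⁵ - 1) r, Y₂ =
-- Y₁ + (q⁵ - 1)(q r + q⁵ - q) and n (q³ - q)(q³ - q²) = Y₂ - (q + q²) Y₁ + q³ b. The first three
-- fix the right side of the last, and its factor q³ (q - 1)² (q + 1) is cancelled.
solve-moments : ∀ q → 1 < q → ∀ {b n Y₁ Y₂} → let r = q ^ 4 + q ^ 2 + 1; h = q ^ 5 in
  q ^ 3 * b + r ≡ q ^ 7 * r + b →
  Y₁ + r ≡ h * r + b →
  Y₂ + (h * q + (q * r + h)) ≡ h * (q * r + h) + (Y₁ + q) →
  Y₂ + q ^ 3 * b + n * (q ^ 5 + q ^ 4) ≡ (q + q ^ 2) * Y₁ + n * (q ^ 6 + q ^ 3) →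
  n ≡ q ^ 2 + 1
solve-moments (suc zero) (s≤s ())
solve-moments (suc (suc p)) _ {b} {n} {Y₁} {Y₂} e₁ e₂ e₃ e₄ =
  *-cancelʳ-≡ n (q ^ 2 + 1) (q ^ 3 * (suc p * suc p) * suc q)
    (+-cancelˡ-≡ ((q + q ^ 2) * Y₀ + n * (q ^ 5 + q ^ 4)) _ _
      (trans (sym (left p n ((q + q ^ 2) * Y₀))) (trans (sym e₄′) (trans (cong (_+ n * (q ^ 5 + q ^ 4)) final)
        (right ((q + q ^ 2) * Y₀) ((q ^ 2 + 1) * (q ^ 3 * (suc p * suc p) * suc q)) (n * (q ^ 5 + q ^ 4)))))))
  where
  open Moments p
  open +-*-Solver

  b≡ : b ≡ b₀
  b≡ = *-cancelˡ-≡ b b₀ (suc p * suc (q ^ 2 + q)) (+-cancelʳ-≡ (b + r) _ _ (trans (sym (l p b r)) (trans e₁ (b-identity b))))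
    where
    l : ∀ p b r → let q = 2 + p in q ^ 3 * b + r ≡ suc p * suc (q ^ 2 + q) * b + (b + r)
    l = solve 3 (λ p b r → let q = con 2 :+ p in
      q :^ 3 :* b :+ r := (con 1 :+ p) :* (con 1 :+ (q :^ 2 :+ q)) :* b :+ (b :+ r)) refl

  Y₁≡ : Y₁ ≡ Y₀
  Y₁≡ = +-cancelʳ-≡ r _ _ (trans e₂ (trans (cong (q ^ 5 * r +_) b≡) (s p r b₀)))
    where
    s : ∀ p r b → let q = 2 + p in q ^ 5 * r + b ≡ b + suc p * (q ^ 4 + q ^ 3 + q ^ 2 + q + 1) * r + r
    s = solve 3 (λ p r b → let q = con 2 :+ p in
      q :^ 5 :* r :+ b := b :+ (con 1 :+ p) :* (q :^ 4 :+ q :^ 3 :+ q :^ 2 :+ q :+ con 1) :* r :+ r) refl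

  Y₂≡ : Y₂ ≡ Z₀
  Y₂≡ = +-cancelʳ-≡ (q ^ 5 * q + (q * r + q ^ 5)) _ _
    (trans e₃ (trans (cong (λ y → q ^ 5 * (q * r + q ^ 5) + (y + q)) Y₁≡) (s p r Y₀)))
    where
    s : ∀ p r y → let q = 2 + p in q ^ 5 * (q * r + q ^ 5) + (y + q) ≡
        y + suc p * (q ^ 4 + q ^ 3 + q ^ 2 + q + 1) * (q * r + q * suc p * (q ^ 3 + q ^ 2 + q + 1)) + (q ^ 5 * q + (q * r + q ^ 5))
    s = solve 3 (λ p r y → let q = con 2 :+ p in q :^ 5 :* (q :* r :+ q :^ 5) :+ (y :+ q) :=
        y :+ (con 1 :+ p) :* (q :^ 4 :+ q :^ 3 :+ q :^ 2 :+ q :+ con 1) :*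
          (q :* r :+ q :* (con 1 :+ p) :* (q :^ 3 :+ q :^ 2 :+ q :+ con 1)) :+ (q :^ 5 :* q :+ (q :* r :+ q :^ 5))) refl

  e₄′ : Z₀ + q ^ 3 * b₀ + n * (q ^ 5 + q ^ 4) ≡ (q + q ^ 2) * Y₀ + n * (q ^ 6 + q ^ 3)
  e₄′ = subst (λ b → Z₀ + q ^ 3 * b + n * (q ^ 5 + q ^ 4) ≡ (q + q ^ 2) * Y₀ + n * (q ^ 6 + q ^ 3)) b≡
    (subst₂ (λ y z → z + q ^ 3 * b + n * (q ^ 5 + q ^ 4) ≡ (q + q ^ 2) * y + n * (q ^ 6 + q ^ 3)) Y₁≡ Y₂≡ e₄)

  left : ∀ p n Y → let q = 2 + p in
    Y + n * (q ^ 6 + q ^ 3) ≡ Y + n * (q ^ 5 + q ^ 4) + n * (q ^ 3 * (suc p * suc p) * suc q)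
  left = solve 3 (λ p n Y → let q = con 2 :+ p in
    Y :+ n :* (q :^ 6 :+ q :^ 3) :=
    Y :+ n :* (q :^ 5 :+ q :^ 4) :+ n :* (q :^ 3 :* ((con 1 :+ p) :* (con 1 :+ p)) :* (con 1 :+ q))) refl

  right : ∀ x y z → x + y + z ≡ x + z + y
  right = solve 3 (λ x y z → x :+ y :+ z := x :+ z :+ y) refl

-- `N` stands for the number of new blocks through T, `G` for the number of pairs of such a block
-- and one of its vectors outside T, and `X` for the same number with the q² + 1 spaces B^⊥ in place
-- of the new blocks, B being an old block in T^⊥.
solve-λ : ∀ q → 1 < q → ∀ {N G X} →
  N * q ^ 2 + G ≡ N * q ^ 3 → G + X + q ^ 2 ≡ q ^ 7 →
  X + (q ^ 2 + 1) * q ^ 2 ≡ (q ^ 2 + 1) * q ^ 4 → N ≡ q ^ 4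
solve-λ (suc zero) (s≤s ())
solve-λ (suc (suc p)) _ {N} {G} {X} e₁ e₂ e₃ = *-cancelʳ-≡ N (q ^ 4) (suc p * q ^ 2)
  (+-cancelʳ-≡ (N * q ^ 2 + (q ^ 2 + 1) * q ^ 4 + q ^ 2) _ _ (begin
    N * (suc p * q ^ 2) + (N * q ^ 2 + (q ^ 2 + 1) * q ^ 4 + q ^ 2) ≡⟨ l p N ⟩
    N * q ^ 3 + (q ^ 2 + 1) * q ^ 4 + q ^ 2                         ≡⟨ cong₂ (λ a b → a + b + q ^ 2) (sym e₁) (sym e₃) ⟩
    (N * q ^ 2 + G) + (X + (q ^ 2 + 1) * q ^ 2) + q ^ 2             ≡⟨ m (N * q ^ 2) G X _ _ ⟩
    (G + X + q ^ 2) + (N * q ^ 2 + (q ^ 2 + 1) * q ^ 2)             ≡⟨ cong (_+ (N * q ^ 2 + (q ^ 2 + 1) * q ^ 2)) e₂ ⟩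
    q ^ 7 + (N * q ^ 2 + (q ^ 2 + 1) * q ^ 2)                       ≡⟨ s p N ⟩
    q ^ 4 * (suc p * q ^ 2) + (N * q ^ 2 + (q ^ 2 + 1) * q ^ 4 + q ^ 2) ∎))
  where
  open ≡-Reasoning
  q = 2 + p
  l : ∀ p N → let q = 2 + p in
      N * (suc p * q ^ 2) + (N * q ^ 2 + (q ^ 2 + 1) * q ^ 4 + q ^ 2) ≡ N * q ^ 3 + (q ^ 2 + 1) * q ^ 4 + q ^ 2
  l = solve 2 (λ p N → let q = con 2 :+ p in
      N :* ((con 1 :+ p) :* q :^ 2) :+ (N :* q :^ 2 :+ (q :^ 2 :+ con 1) :* q :^ 4 :+ q :^ 2)
      := N :* q :^ 3 :+ (q :^ 2 :+ con 1) :* q :^ 4 :+ q :^ 2) refl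
    where open +-*-Solver
  m : ∀ a g x c d → (a + g) + (x + c) + d ≡ (g + x + d) + (a + c)
  m = solve 5 (λ a g x c d → (a :+ g) :+ (x :+ c) :+ d := (g :+ x :+ d) :+ (a :+ c)) refl
    where open +-*-Solver
  s : ∀ p N → let q = 2 + p in q ^ 7 + (N * q ^ 2 + (q ^ 2 + 1) * q ^ 2) ≡
      q ^ 4 * (suc p * q ^ 2) + (N * q ^ 2 + (q ^ 2 + 1) * q ^ 4 + q ^ 2)
  s = solve 2 (λ p N → let q = con 2 :+ p in q :^ 7 :+ (N :* q :^ 2 :+ (q :^ 2 :+ con 1) :* q :^ 2) :=
      q :^ 4 :* ((con 1 :+ p) :* q :^ 2) :+ (N :* q :^ 2 :+ (q :^ 2 :+ con 1) :* q :^ 4 :+ q :^ 2)) refl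
    where open +-*-Solver

-- Linear algebra over a finite field

module LinearAlgebra {q : ℕ} (F : FiniteField q) where
  open FiniteField F using (0#; 1#; 0≢1; inverse; isCommutativeRing)
    renaming (_+_ to infixl 6 _+ᶠ_; _*_ to infixl 7 _*ᶠ_; -_ to infix 8 -ᶠ_)

  commutativeRing : CommutativeRing _ _
  commutativeRing = record { isCommutativeRing = isCommutativeRing }

  private
    module R = CommutativeRing commutativeRing
    module RP = RingProperties R.ring

  infixl 6 _⊹_
  infixr 7 _•_

  _⊹_ : ∀ {n} → Vector F n → Vector F n → Vector F n
  _⊹_ = _⊕_ F

  _•_ : ∀ {n} → Fin q → Vector F n → Vector F n
  _•_ = _⊙_ F

  0ᵥ : ∀ {n} → Vector F n
  0ᵥ = zeroV F

  lin : ∀ {n k} → (Fin k → Fin q) → (Fin k → Vector F n) → Vector F n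
  lin = linComb F _

  open module V {n} = Counting (finite-Vec q n) public
  module Q = Counting (finite-Fin q)

  -- The counting equations are solved by cancelling multiples of q - 1, which must be nonzero.
  1<q : 1 < q
  1<q = two-elements 0# 1# 0≢1
    where
    two-elements : ∀ {m} (i j : Fin m) → i ≢ j → 1 < m
    two-elements {suc zero}    Fin.zero Fin.zero i≢j = ⊥-elim (i≢j refl)
    two-elements {suc (suc m)} i        j        i≢j = s≤s (s≤s z≤n)

  medial : ∀ a b c d → (a +ᶠ b) +ᶠ (c +ᶠ d) ≡ (a +ᶠ c) +ᶠ (b +ᶠ d)
  medial a b c d = begin
    a +ᶠ b +ᶠ (c +ᶠ d)   ≡⟨ R.+-assoc a b _ ⟩
    a +ᶠ (b +ᶠ (c +ᶠ d)) ≡⟨ cong (a +ᶠ_) (sym (R.+-assoc b c d)) ⟩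
    a +ᶠ (b +ᶠ c +ᶠ d)   ≡⟨ cong (λ e → a +ᶠ (e +ᶠ d)) (R.+-comm b c) ⟩
    a +ᶠ (c +ᶠ b +ᶠ d)   ≡⟨ cong (a +ᶠ_) (R.+-assoc c b d) ⟩
    a +ᶠ (c +ᶠ (b +ᶠ d)) ≡⟨ sym (R.+-assoc a c _) ⟩
    a +ᶠ c +ᶠ (b +ᶠ d)   ∎
    where open ≡-Reasoning

  ⊹-identityˡ : ∀ {n} (u : Vector F n) → 0ᵥ ⊹ u ≡ u
  ⊹-identityˡ = Vecₚ.zipWith-identityˡ R.+-identityˡ

  ⊹-identityʳ : ∀ {n} (u : Vector F n) → u ⊹ 0ᵥ ≡ u
  ⊹-identityʳ = Vecₚ.zipWith-identityʳ R.+-identityʳ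

  ⊹-medial : ∀ {n} (a b c d : Vector F n) → (a ⊹ b) ⊹ (c ⊹ d) ≡ (a ⊹ c) ⊹ (b ⊹ d)
  ⊹-medial []      []      []      []      = refl
  ⊹-medial (a ∷ u) (b ∷ v) (c ∷ w) (d ∷ x) = cong₂ _∷_ (medial a b c d) (⊹-medial u v w x)

  •-distribˡ : ∀ {n} a (u v : Vector F n) → a • (u ⊹ v) ≡ a • u ⊹ a • v
  •-distribˡ a []      []      = refl
  •-distribˡ a (x ∷ u) (y ∷ v) = cong₂ _∷_ (R.distribˡ a x y) (•-distribˡ a u v)

  •-distribʳ : ∀ {n} a b (u : Vector F n) → (a +ᶠ b) • u ≡ a • u ⊹ b • u
  •-distribʳ a b []      = refl
  •-distribʳ a b (x ∷ u) = cong₂ _∷_ (R.distribʳ x a b) (•-distribʳ a b u)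

  •-assoc : ∀ {n} a b (u : Vector F n) → (a *ᶠ b) • u ≡ a • (b • u)
  •-assoc a b []      = refl
  •-assoc a b (x ∷ u) = cong₂ _∷_ (R.*-assoc a b x) (•-assoc a b u)

  •-identity : ∀ {n} (u : Vector F n) → 1# • u ≡ u
  •-identity []      = refl
  •-identity (x ∷ u) = cong₂ _∷_ (R.*-identityˡ x) (•-identity u)

  •-zeroˡ : ∀ {n} (u : Vector F n) → 0# • u ≡ 0ᵥ
  •-zeroˡ []      = refl
  •-zeroˡ (x ∷ u) = cong₂ _∷_ (R.zeroˡ x) (•-zeroˡ u)

  •-zeroʳ : ∀ {n} a → a • 0ᵥ {n} ≡ 0ᵥ
  •-zeroʳ {zero}  a = refl
  •-zeroʳ {suc n} a = cong₂ _∷_ (R.zeroʳ a) (•-zeroʳ a)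

  -- Subtraction is written as adding (-1) • w, so that `+∈` and `•∈` give closure of subspaces
  -- under it.
  ⊹-cancel : ∀ {n} (u w : Vector F n) → (u ⊹ w) ⊹ (-ᶠ 1#) • w ≡ u
  ⊹-cancel []      []      = refl
  ⊹-cancel (x ∷ u) (y ∷ w) = cong₂ _∷_ scalar (⊹-cancel u w)
    where
    open ≡-Reasoning
    scalar : (x +ᶠ y) +ᶠ -ᶠ 1# *ᶠ y ≡ x
    scalar = begin
      (x +ᶠ y) +ᶠ -ᶠ 1# *ᶠ y ≡⟨ cong (x +ᶠ y +ᶠ_) (RP.-1*x≈-x y) ⟩
      (x +ᶠ y) +ᶠ -ᶠ y       ≡⟨ R.+-assoc x y _ ⟩
      x +ᶠ (y +ᶠ -ᶠ y)       ≡⟨ cong (x +ᶠ_) (R.-‿inverseʳ y) ⟩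
      x +ᶠ 0#                ≡⟨ R.+-identityʳ x ⟩
      x                      ∎

  ⊹-cancel′ : ∀ {n} (u w : Vector F n) → (u ⊹ (-ᶠ 1#) • w) ⊹ w ≡ u
  ⊹-cancel′ u w = begin
    (u ⊹ (-ᶠ 1#) • w) ⊹ w                          ≡⟨ cong (u ⊹ (-ᶠ 1#) • w ⊹_) (sym negneg) ⟩
    (u ⊹ (-ᶠ 1#) • w) ⊹ (-ᶠ 1#) • ((-ᶠ 1#) • w)    ≡⟨ ⊹-cancel u _ ⟩
    u                                              ∎
    where
    open ≡-Reasoning
    negneg : (-ᶠ 1#) • ((-ᶠ 1#) • w) ≡ w
    negneg = begin
      (-ᶠ 1#) • ((-ᶠ 1#) • w) ≡⟨ sym (•-assoc _ _ w) ⟩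
      (-ᶠ 1# *ᶠ -ᶠ 1#) • w    ≡⟨ cong (_• w) (trans (RP.-1*x≈-x _) (RP.-‿involutive 1#)) ⟩
      1# • w                  ≡⟨ •-identity w ⟩
      w                       ∎

  solve-for : ∀ {n} {c y} (x w : Vector F n) → c *ᶠ y ≡ 1# → c • x ⊹ w ≡ 0ᵥ → x ≡ (-ᶠ y) • w
  solve-for         []      []      cy h = refl
  solve-for {c = c} {y} (a ∷ x) (b ∷ w) cy h = cong₂ _∷_ scalar (solve-for x w cy (Vecₚ.∷-injectiveʳ h))
    where
    open ≡-Reasoning
    scalar : a ≡ -ᶠ y *ᶠ b
    scalar = begin
      a                     ≡⟨ sym (R.*-identityˡ a) ⟩
      1# *ᶠ a               ≡⟨ cong (_*ᶠ a) (trans (sym cy) (R.*-comm c y)) ⟩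
      y *ᶠ c *ᶠ a           ≡⟨ R.*-assoc y c a ⟩
      y *ᶠ (c *ᶠ a)         ≡⟨ cong (y *ᶠ_) (RP.+-inverseˡ-unique (c *ᶠ a) b (Vecₚ.∷-injectiveˡ h)) ⟩
      y *ᶠ -ᶠ b             ≡⟨ sym (RP.-‿distribʳ-* y b) ⟩
      -ᶠ (y *ᶠ b)           ≡⟨ RP.-‿distribˡ-* y b ⟩
      -ᶠ y *ᶠ b             ∎

  -- The standard bilinear form and subspaces

  dot : ∀ {n} → Vector F n → Vector F n → Fin q
  dot []      []      = 0#
  dot (x ∷ u) (y ∷ v) = x *ᶠ y +ᶠ dot u v

  dot-comm : ∀ {n} (u v : Vector F n) → dot u v ≡ dot v u
  dot-comm []      []      = refl
  dot-comm (x ∷ u) (y ∷ v) = cong₂ _+ᶠ_ (R.*-comm x y) (dot-comm u v)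

  dot-⊹ : ∀ {n} (x u v : Vector F n) → dot x (u ⊹ v) ≡ dot x u +ᶠ dot x v
  dot-⊹ []      []      []      = sym (R.+-identityˡ 0#)
  dot-⊹ (x ∷ w) (a ∷ u) (b ∷ v) = trans (cong₂ _+ᶠ_ (R.distribˡ x a b) (dot-⊹ w u v)) (medial _ _ _ _)

  dot-• : ∀ {n} c (x u : Vector F n) → dot x (c • u) ≡ c *ᶠ dot x u
  dot-• c []      []      = sym (R.zeroʳ c)
  dot-• c (x ∷ w) (a ∷ u) = trans (cong₂ _+ᶠ_ scalar (dot-• c w u)) (sym (R.distribˡ c _ _))
    where
    scalar : x *ᶠ (c *ᶠ a) ≡ c *ᶠ (x *ᶠ a)
    scalar = trans (sym (R.*-assoc x c a)) (trans (cong (_*ᶠ a) (R.*-comm x c)) (R.*-assoc c x a))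

  dot-zeroʳ : ∀ {n} (x : Vector F n) → dot x 0ᵥ ≡ 0#
  dot-zeroʳ x = trans (cong (dot x) (sym (•-zeroˡ 0ᵥ))) (trans (dot-• 0# x 0ᵥ) (R.zeroˡ _))

  -- Ensures, in the double counting for `perp`, that the kernel of every nonzero vector is a proper
  -- subspace.
  dot-nondegenerate : ∀ {n} (u : Vector F n) → (∀ x → dot u x ≡ 0#) → u ≡ 0ᵥ
  dot-nondegenerate []      h = refl
  dot-nondegenerate (a ∷ u) h = cong₂ _∷_ head (dot-nondegenerate u tail)
    where
    open ≡-Reasoning
    head : a ≡ 0#
    head = begin
      a                             ≡⟨ sym (R.*-identityʳ a) ⟩
      a *ᶠ 1#                       ≡⟨ sym (R.+-identityʳ _) ⟩
      a *ᶠ 1# +ᶠ 0#                 ≡⟨ cong (a *ᶠ 1# +ᶠ_) (sym (dot-zeroʳ u)) ⟩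
      dot (a ∷ u) (1# ∷ 0ᵥ)         ≡⟨ h (1# ∷ 0ᵥ) ⟩
      0#                            ∎
    tail : ∀ x → dot u x ≡ 0#
    tail x = begin
      dot u x                       ≡⟨ sym (R.+-identityˡ _) ⟩
      0# +ᶠ dot u x                 ≡⟨ cong (_+ᶠ dot u x) (sym (R.zeroʳ a)) ⟩
      dot (a ∷ u) (0# ∷ x)          ≡⟨ h (0# ∷ x) ⟩
      0#                            ∎

  -- Closure conditions and no basis: kernels, intersections and orthogonal complements qualify at
  -- once, and their sizes are obtained by counting.
  record IsSubspace {n} (S : Subset F n) : Set where
    field
      0∈ : S 0ᵥ ≡ true
      +∈ : ∀ {u v} → S u ≡ true → S v ≡ true → S (u ⊹ v) ≡ true
      •∈ : ∀ c {u} → S u ≡ true → S (c • u) ≡ true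
  open IsSubspace public

  full : ∀ {n} → Subset F n
  full _ = true

  full-isSubspace : ∀ {n} → IsSubspace (full {n})
  full-isSubspace = record { 0∈ = refl ; +∈ = λ _ _ → refl ; •∈ = λ _ _ → refl }

  #-full : ∀ n → # (full {n}) ≡ q ^ n
  #-full n = trans (∑-allVectors-const q n 1) (*-identityʳ _)

  _∩_ : ∀ {n} → Subset F n → Subset F n → Subset F n
  (S ∩ U) v = S v ∧ U v

  ∩-isSubspace : ∀ {n} {S U : Subset F n} → IsSubspace S → IsSubspace U → IsSubspace (S ∩ U)
  ∩-isSubspace {S = S} hS hU = record
    { 0∈ = ∧-intro (0∈ hS) (0∈ hU)
    ; +∈ = λ {u} {v} hu hv → ∧-intro (+∈ hS (∧-elimˡ hu) (∧-elimˡ hv)) (+∈ hU (∧-elimʳ {S u} hu) (∧-elimʳ {S v} hv))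
    ; •∈ = λ c {u} hu → ∧-intro (•∈ hS c (∧-elimˡ hu)) (•∈ hU c (∧-elimʳ {S u} hu)) }

  ker : ∀ {n} → Vector F n → Subset F n
  ker x u = dot x u Q.== 0#

  ker⁺ : ∀ {n} {x u : Vector F n} → dot x u ≡ 0# → ker x u ≡ true
  ker⁺ {x = x} {u} h = trans (cong (Q._== 0#) h) (Q.==-refl 0#)

  ker⁻ : ∀ {n} {x u : Vector F n} → ker x u ≡ true → dot x u ≡ 0#
  ker⁻ = Q.==⇒≡

  ker-comm : ∀ {n} (x u : Vector F n) → ker x u ≡ ker u x
  ker-comm x u = cong (Q._== 0#) (dot-comm x u)

  ker-isSubspace : ∀ {n} (x : Vector F n) → IsSubspace (ker x)
  ker-isSubspace x = record
    { 0∈ = ker⁺ {x = x} (dot-zeroʳ x)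
    ; +∈ = λ {u} {v} hu hv → ker⁺ {x = x} (trans (dot-⊹ x u v)
        (trans (cong₂ _+ᶠ_ (ker⁻ {x = x} hu) (ker⁻ {x = x} hv)) (R.+-identityˡ 0#)))
    ; •∈ = λ c {u} hu → ker⁺ {x = x} (trans (dot-• c x u) (trans (cong (c *ᶠ_) (ker⁻ {x = x} hu)) (R.zeroʳ c))) }

  subspace-translate : ∀ {n} {S : Subset F n} → IsSubspace S → ∀ {w} → S w ≡ true → ∀ u → S (u ⊹ w) ≡ S u
  subspace-translate {S = S} hS {w} hw u = Bool-ext
    (λ h → subst (λ v → S v ≡ true) (⊹-cancel u w) (+∈ hS h (•∈ hS (-ᶠ 1#) hw)))
    (λ h → +∈ hS h hw)

  -- Translating by a multiple of u₀ identifies all fibres of dot x on S.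
  #-ker : ∀ {n} {S : Subset F n} → IsSubspace S → ∀ x u₀ → S u₀ ≡ true → dot x u₀ ≢ 0# →
          q * # (S ∩ ker x) ≡ # S
  #-ker {n} {S} hS x u₀ Su₀ x·u₀≢0 = sym (begin
    # S
      ≡⟨ ∑-cong V (λ u → trans (sym (*-identityʳ _)) (cong (χ (S u) *_) (sym (one (dot x u))))) ⟩
    ∑ V (λ u → χ (S u) * ∑ (allFin q) (λ c → χ (c Q.== dot x u)))
      ≡⟨ ∑-cong V (λ u → sym (∑-*ˡ (allFin q) (χ (S u)) _)) ⟩
    ∑ V (λ u → ∑ (allFin q) (λ c → χ (S u) * χ (c Q.== dot x u)))
      ≡⟨ ∑-swap V (allFin q) _ ⟩
    ∑ (allFin q) (λ c → ∑ V (λ u → χ (S u) * χ (c Q.== dot x u)))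
      ≡⟨ ∑-cong (allFin q) fibre ⟩
    ∑ (allFin q) (λ c → # (S ∩ ker x))
      ≡⟨ ∑-allFin-const q _ ⟩
    q * # (S ∩ ker x) ∎)
    where
    open ≡-Reasoning
    V = allVectors q n
    one : ∀ a → ∑ (allFin q) (λ c → χ (c Q.== a)) ≡ 1
    one = Finite.once (finite-Fin q)
    a⁻¹ = proj₁ (inverse (dot x u₀) x·u₀≢0)
    fibre : ∀ c → ∑ V (λ u → χ (S u) * χ (c Q.== dot x u)) ≡ # (S ∩ ker x)
    fibre c = trans
      (sym (∑-reindex (_⊹ w) (_⊹ (-ᶠ 1#) • w) (λ u → ⊹-cancel u w) (λ u → ⊹-cancel′ u w) _))
      (∑-cong V (λ u → trans
        (cong₂ (λ a b → χ a * χ b) (subspace-translate hS (•∈ hS _ Su₀) u) (shift u))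
        (sym (χ-∧ (S u) (ker x u)))))
      where
      w = (c *ᶠ a⁻¹) • u₀
      x·w : dot x w ≡ c
      x·w = begin
        dot x w                     ≡⟨ dot-• _ x u₀ ⟩
        c *ᶠ a⁻¹ *ᶠ dot x u₀        ≡⟨ R.*-assoc c _ _ ⟩
        c *ᶠ (a⁻¹ *ᶠ dot x u₀)      ≡⟨ cong (c *ᶠ_) (trans (R.*-comm _ _) (proj₂ (inverse (dot x u₀) x·u₀≢0))) ⟩
        c *ᶠ 1#                     ≡⟨ R.*-identityʳ c ⟩
        c                           ∎
      x·uw : ∀ u → dot x (u ⊹ w) ≡ dot x u +ᶠ c
      x·uw u = trans (dot-⊹ x u w) (cong (dot x u +ᶠ_) x·w)
      shift : ∀ u → (c Q.== dot x (u ⊹ w)) ≡ ker x u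
      shift u = Bool-ext
        (λ e → ker⁺ {x = x} (RP.+-cancelʳ c _ _ (trans (sym (x·uw u)) (trans (sym (Q.==⇒≡ e)) (sym (R.+-identityˡ c))))))
        (λ e → dec-true (c Finₚ.≟ _) (sym (trans (x·uw u) (trans (cong (_+ᶠ c) (ker⁻ {x = x} e)) (R.+-identityˡ c)))))

  -- Orthogonal complements

  perp : ∀ {n} → Subset F n → Subset F n
  perp S x = S ⊆ ker x

  perp-isSubspace : ∀ {n} (S : Subset F n) → IsSubspace (perp S)
  perp-isSubspace S = record
    { 0∈ = ⊆⁺ {P = S} (λ u _ → flip u (0∈ (ker-isSubspace u)))
    ; +∈ = λ {x} {y} hx hy → ⊆⁺ {P = S} (λ u Su → flip u (+∈ (ker-isSubspace u) {x} {y} (use hx u Su) (use hy u Su)))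
    ; •∈ = λ c {x} hx → ⊆⁺ {P = S} (λ u Su → flip u (•∈ (ker-isSubspace u) c {x} (use hx u Su))) }
    where
    flip : ∀ u {x} → ker u x ≡ true → ker x u ≡ true
    flip u {x} h = trans (ker-comm x u) h
    use : ∀ {x} → perp S x ≡ true → ∀ u → S u ≡ true → ker u x ≡ true
    use {x} hx u Su = trans (ker-comm u x) (⊆⁻ {P = S} hx u Su)

  -- A linear functional on S is zero or onto. Passing in this way to a subspace of index 1 or q is
  -- the basic step of every dimension argument below.
  #-ker-or-perp : ∀ {n} {S : Subset F n} → IsSubspace S → ∀ x →
                  (perp S x ≡ true × # (S ∩ ker x) ≡ # S) ⊎ (perp S x ≡ false × q * # (S ∩ ker x) ≡ # S)
  #-ker-or-perp {S = S} hS x with true-or-false (perp S x)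
  ... | inj₁ h = inj₁ (h , #-cong (λ u → Bool-ext {S u ∧ ker x u} ∧-elimˡ (λ Su → ∧-intro Su (⊆⁻ {P = S} h u Su))))
  ... | inj₂ h with ⊆-false {P = S} h
  ...   | u₀ , Su₀ , e = inj₂ (h , #-ker hS x u₀ Su₀
          (λ z → true≢false (trans (sym (ker⁺ {x = x} z)) e)))

  -- Double counting of {(x , u) : u ∈ U, x · u = 0}.
  #-perp : ∀ {n} {U : Subset F n} → IsSubspace U → # (perp U) * # U ≡ q ^ n
  #-perp {n} {U} hU = cancel q 1<q {Z = Z} {M = N * u} {PU = P * u} {N = N} by-x by-u
    where
    open ≡-Reasoning
    V = allVectors q n
    N = q ^ n
    u = # U
    P = # (perp U)
    Z = ∑ V (λ x → # (U ∩ ker x))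

    -- With differences restored, `by-x` says q Z = N u + (q - 1) P u, as exactly the x in U^⊥
    -- annihilate all of U. `by-u` says q Z = N u + (q - 1) N, as only the zero vector has the whole
    -- space as kernel. Comparison leaves P u = N.
    cancel : ∀ q → 1 < q → ∀ {Z M PU N} → q * Z + PU ≡ M + q * PU → q * Z + N ≡ M + q * N → PU ≡ N
    cancel (suc zero)    (s≤s ())
    cancel (suc (suc p)) _ {Z} {M} {PU} {N} e₁ e₂ = *-cancelˡ-≡ PU N (suc p)
      (+-cancelˡ-≡ M _ _ (trans (sym (lemma PU e₁)) (lemma N e₂)))
      where
      lemma : ∀ X → suc (suc p) * Z + X ≡ M + suc (suc p) * X → suc (suc p) * Z ≡ M + suc p * X
      lemma X e = +-cancelʳ-≡ X _ _ (trans e (rearrange p M X))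
        where
        rearrange : ∀ p M X → M + suc (suc p) * X ≡ M + suc p * X + X
        rearrange = solve 3 (λ p M X → M :+ (con 2 :+ p) :* X := M :+ (con 1 :+ p) :* X :+ X) refl
          where open +-*-Solver

    pointwise-x : ∀ x → q * # (U ∩ ker x) + χ (perp U x) * u ≡ u + q * (χ (perp U x) * u)
    pointwise-x x with #-ker-or-perp hU x
    ... | inj₁ (h , e) rewrite h | e = trans (+-comm (q * u) _) (arith q u)
      where
      arith : ∀ q u → 1 * u + q * u ≡ u + q * (1 * u)
      arith = solve 2 (λ q u → con 1 :* u :+ q :* u := u :+ q :* (con 1 :* u)) refl
        where open +-*-Solver
    ... | inj₂ (h , e) rewrite h | e = cong (u +_) (sym (*-zeroʳ q))

    by-x : q * Z + P * u ≡ N * u + q * (P * u)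
    by-x = begin
      q * Z + P * u
        ≡⟨ cong₂ _+_ (sym (∑-*ˡ V q _)) (sym (∑-*ʳ V u _)) ⟩
      ∑ V (λ x → q * # (U ∩ ker x)) + ∑ V (λ x → χ (perp U x) * u)
        ≡⟨ sym (∑-+ V _ _) ⟩
      ∑ V (λ x → q * # (U ∩ ker x) + χ (perp U x) * u)
        ≡⟨ ∑-cong V pointwise-x ⟩
      ∑ V (λ x → u + q * (χ (perp U x) * u))
        ≡⟨ ∑-+ V _ _ ⟩
      ∑ V (λ x → u) + ∑ V (λ x → q * (χ (perp U x) * u))
        ≡⟨ cong₂ _+_ (∑-allVectors-const q n u) (trans (∑-*ˡ V q _) (cong (q *_) (∑-*ʳ V u _))) ⟩
      N * u + q * (P * u) ∎

    pointwise-u : ∀ v → q * (χ (U v) * # (ker v)) + χ (v == 0ᵥ) * N ≡ χ (U v) * N + q * (χ (v == 0ᵥ) * N)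
    pointwise-u v with true-or-false (v == 0ᵥ)
    ... | inj₁ e = subst (λ v → q * (χ (U v) * # (ker v)) + χ (v == 0ᵥ) * N ≡ χ (U v) * N + q * (χ (v == 0ᵥ) * N))
                     (sym (==⇒≡ {x = v} e)) at-zero
      where
      ker-0 : # (ker (0ᵥ {n})) ≡ N
      ker-0 = trans (#-cong {P = ker (0ᵥ {n})} {Q = full}
        (λ x → ker⁺ {x = 0ᵥ} {u = x} (trans (dot-comm 0ᵥ x) (dot-zeroʳ x)))) (#-full n)
      at-zero : q * (χ (U 0ᵥ) * # (ker (0ᵥ {n}))) + χ (0ᵥ {n} == 0ᵥ) * N ≡ χ (U 0ᵥ) * N + q * (χ (0ᵥ {n} == 0ᵥ) * N)
      at-zero rewrite 0∈ hU | ==-refl (0ᵥ {n}) | ker-0 = +-comm (q * (1 * N)) _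
    ... | inj₂ e with #-ker-or-perp full-isSubspace v
    ...   | inj₁ (h , _) = ⊥-elim (true≢false (trans (sym (dec-true (Vecₚ.≡-dec Finₚ._≟_ v 0ᵥ)
              (dot-nondegenerate v (λ x → ker⁻ {x = v} (⊆⁻ {P = full} h x refl))))) e))
    ...   | inj₂ (_ , k) rewrite e | *-zeroʳ q = trans (+-identityʳ _) (trans (arith q (χ (U v)) (# (ker v)))
              (trans (cong (χ (U v) *_) (trans k (#-full n))) (sym (+-identityʳ _))))
      where
      arith : ∀ q c k → q * (c * k) ≡ c * (q * k)
      arith = solve 3 (λ q c k → q :* (c :* k) := c :* (q :* k)) refl
        where open +-*-Solver

    Z-swap : Z ≡ ∑ V (λ v → χ (U v) * # (ker v))
    Z-swap = trans (∑-swap V V _) (∑-cong V (λ v → trans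
      (∑-cong V (λ x → trans (χ-∧ (U v) (ker x v)) (cong (λ b → χ (U v) * χ b) (ker-comm x v))))
      (∑-*ˡ V (χ (U v)) _)))

    ∑-zeroN : ∑ V (λ v → χ (v == 0ᵥ) * N) ≡ N
    ∑-zeroN = ∑-point (0ᵥ {n}) (λ _ → N)

    by-u : q * Z + N ≡ N * u + q * N
    by-u = begin
      q * Z + N
        ≡⟨ cong₂ _+_ (trans (cong (q *_) Z-swap) (sym (∑-*ˡ V q _))) (sym ∑-zeroN) ⟩
      ∑ V (λ v → q * (χ (U v) * # (ker v))) + ∑ V (λ v → χ (v == 0ᵥ) * N)
        ≡⟨ sym (∑-+ V _ _) ⟩
      ∑ V (λ v → q * (χ (U v) * # (ker v)) + χ (v == 0ᵥ) * N)
        ≡⟨ ∑-cong V pointwise-u ⟩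
      ∑ V (λ v → χ (U v) * N + q * (χ (v == 0ᵥ) * N))
        ≡⟨ ∑-+ V _ _ ⟩
      ∑ V (λ v → χ (U v) * N) + ∑ V (λ v → q * (χ (v == 0ᵥ) * N))
        ≡⟨ cong₂ _+_ (trans (∑-*ʳ V N _) (*-comm u N)) (trans (∑-*ˡ V q _) (cong (q *_) ∑-zeroN)) ⟩
      N * u + q * N ∎

  -- Linear combinations, spans and dimension

  lin-cong : ∀ {n k} {c d : Fin k → Fin q} (b : Fin k → Vector F n) → (∀ i → c i ≡ d i) → lin c b ≡ lin d b
  lin-cong {k = zero}  b h = refl
  lin-cong {k = suc k} b h = cong₂ _⊹_ (cong (_• b Fin.zero) (h Fin.zero)) (lin-cong (b ∘ Fin.suc) (h ∘ Fin.suc))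

  lin-zero : ∀ {n k} (b : Fin k → Vector F n) → lin (λ _ → 0#) b ≡ 0ᵥ
  lin-zero {k = zero}  b = refl
  lin-zero {k = suc k} b = trans (cong₂ _⊹_ (•-zeroˡ (b Fin.zero)) (lin-zero (b ∘ Fin.suc))) (⊹-identityˡ 0ᵥ)

  lin-+ : ∀ {n k} (c d : Fin k → Fin q) (b : Fin k → Vector F n) →
          lin (λ i → c i +ᶠ d i) b ≡ lin c b ⊹ lin d b
  lin-+ {k = zero}  c d b = sym (⊹-identityˡ 0ᵥ)
  lin-+ {k = suc k} c d b = trans
    (cong₂ _⊹_ (•-distribʳ _ _ (b Fin.zero)) (lin-+ (c ∘ Fin.suc) (d ∘ Fin.suc) (b ∘ Fin.suc)))
    (⊹-medial _ _ _ _)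

  lin-• : ∀ {n k} a (c : Fin k → Fin q) (b : Fin k → Vector F n) → lin (λ i → a *ᶠ c i) b ≡ a • lin c b
  lin-• {k = zero}  a c b = sym (•-zeroʳ a)
  lin-• {k = suc k} a c b = trans
    (cong₂ _⊹_ (•-assoc a _ (b Fin.zero)) (lin-• a (c ∘ Fin.suc) (b ∘ Fin.suc)))
    (sym (•-distribˡ a _ _))

  basis∈span : ∀ {n k} (b : Fin k → Vector F n) i → InSpan F b (b i)
  basis∈span b Fin.zero    = (1# VF.∷ (λ _ → 0#)) ,
    trans (cong₂ _⊹_ (•-identity (b Fin.zero)) (lin-zero (b ∘ Fin.suc))) (⊹-identityʳ _)
  basis∈span b (Fin.suc i) with basis∈span (b ∘ Fin.suc) i
  ... | c , e = (0# VF.∷ c) , trans (cong₂ _⊹_ (•-zeroˡ (b Fin.zero)) e) (⊹-identityˡ _)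

  lin∈ : ∀ {n k} {S : Subset F n} → IsSubspace S → (b : Fin k → Vector F n) → (∀ i → S (b i) ≡ true) →
         ∀ c → S (lin c b) ≡ true
  lin∈ {k = zero}  hS b hb c = 0∈ hS
  lin∈ {k = suc k} hS b hb c = +∈ hS (•∈ hS _ (hb Fin.zero)) (lin∈ hS (b ∘ Fin.suc) (hb ∘ Fin.suc) (c ∘ Fin.suc))

  lin-injective : ∀ {n k} {b : Fin k → Vector F n} → LinearlyIndependent F b →
                  ∀ c d → lin c b ≡ lin d b → ∀ i → c i ≡ d i
  lin-injective {b = b} ind c d e i = trans
    (RP.+-inverseˡ-unique (c i) _ (ind (λ i → c i +ᶠ -ᶠ 1# *ᶠ d i) difference i))
    (trans (cong -ᶠ_ (RP.-1*x≈-x (d i))) (RP.-‿involutive (d i)))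
    where
    open ≡-Reasoning
    difference : lin (λ i → c i +ᶠ -ᶠ 1# *ᶠ d i) b ≡ 0ᵥ
    difference = begin
      lin (λ i → c i +ᶠ -ᶠ 1# *ᶠ d i) b      ≡⟨ lin-+ c _ b ⟩
      lin c b ⊹ lin (λ i → -ᶠ 1# *ᶠ d i) b   ≡⟨ cong₂ _⊹_ e (lin-• (-ᶠ 1#) d b) ⟩
      lin d b ⊹ (-ᶠ 1#) • lin d b            ≡⟨ cong (_⊹ (-ᶠ 1#) • lin d b) (sym (⊹-identityˡ _)) ⟩
      (0ᵥ ⊹ lin d b) ⊹ (-ᶠ 1#) • lin d b     ≡⟨ ⊹-cancel 0ᵥ (lin d b) ⟩
      0ᵥ                                     ∎

  -- A `Subset` is Boolean, so membership is decided by a search over all coefficients. These are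
  -- taken as vectors, which are enumerated and have decidable equality, and not as functions on
  -- `Fin k`.
  span : ∀ {n k} → (Fin k → Vector F n) → Subset F n
  span {k = k} b v = not (every {k} (λ c → not (lin (Vec.lookup c) b == v)))

  span⁺ : ∀ {n k} (b : Fin k → Vector F n) {v} → InSpan F b v → span b v ≡ true
  span⁺ {k = k} b {v} (c , e) with true-or-false (every {k} (λ c → not (lin (Vec.lookup c) b == v)))
  ... | inj₂ h = cong not h
  ... | inj₁ h = ⊥-elim (true≢false (trans (sym (every⁻ {p = λ c → not (lin (Vec.lookup c) b == v)} h (Vec.tabulate c)))
        (cong not (dec-true (Vecₚ.≡-dec Finₚ._≟_ (lin (Vec.lookup (Vec.tabulate c)) b) v)
          (trans (lin-cong b (Vecₚ.lookup∘tabulate c)) e)))))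

  span⁻ : ∀ {n k} (b : Fin k → Vector F n) {v} → span b v ≡ true → InSpan F b v
  span⁻ {k = k} b {v} h with true-or-false (every {k} (λ c → not (lin (Vec.lookup c) b == v)))
  ... | inj₁ e = ⊥-elim (true≢false (trans (sym h) (cong not e)))
  ... | inj₂ e with every-false {p = λ c → not (lin (Vec.lookup c) b == v)} e
  ...   | c , eq = Vec.lookup c , ==⇒≡ (not-injective eq)
    where
    not-injective : ∀ {a} → not a ≡ false → a ≡ true
    not-injective {true} _ = refl

  span-dim : ∀ {n k} (b : Fin k → Vector F n) → LinearlyIndependent F b → IsSubspaceOfDim F k (span b)
  span-dim b ind = b , ind , λ v → span⁻ b , span⁺ b

  dim⇒subspace : ∀ {n k} {S : Subset F n} → IsSubspaceOfDim F k S → IsSubspace S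
  dim⇒subspace {S = S} (b , ind , h) = record
    { 0∈ = proj₂ (h _) ((λ _ → 0#) , lin-zero b)
    ; +∈ = λ Su Sv → add (proj₁ (h _) Su) (proj₁ (h _) Sv)
    ; •∈ = λ a Su → scale a (proj₁ (h _) Su) }
    where
    add : ∀ {u v} → InSpan F b u → InSpan F b v → S (u ⊹ v) ≡ true
    add (c , refl) (d , refl) = proj₂ (h _) (_ , lin-+ c d b)
    scale : ∀ a {u} → InSpan F b u → S (a • u) ≡ true
    scale a (c , refl) = proj₂ (h _) (_ , lin-• a c b)

  lookup-ext : ∀ {k} (c d : Vector F k) → (∀ i → Vec.lookup c i ≡ Vec.lookup d i) → c ≡ d
  lookup-ext c d e = trans (sym (Vecₚ.tabulate∘lookup c)) (trans (Vecₚ.tabulate-cong e) (Vecₚ.tabulate∘lookup d))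

  -- Pairs of a coefficient vector and its combination are counted both ways: spanning gives each
  -- vector of S some coefficients, independence makes them unique, and vectors outside S have none.
  #-dim : ∀ {n k} {S : Subset F n} → IsSubspaceOfDim F k S → # S ≡ q ^ k
  #-dim {n} {k} {S} (b , ind , h) = begin
    ∑ V (χ ∘ S)                                         ≡⟨ ∑-cong V (λ v → sym (coefficients v)) ⟩
    ∑ V (λ v → ∑ C (λ c → χ (comb c == v)))             ≡⟨ ∑-swap V C _ ⟩
    ∑ C (λ c → ∑ V (λ v → χ (comb c == v)))             ≡⟨ ∑-cong C (λ c → #-singleton (comb c) (==-refl (comb c)) (λ v e → sym (==⇒≡ e))) ⟩
    ∑ C (λ c → 1)                                       ≡⟨ #-full k ⟩
    q ^ k                                               ∎
    where
    open ≡-Reasoning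
    V = allVectors q n
    C = allVectors q k
    comb : Vector F k → Vector F n
    comb c = lin (Vec.lookup c) b
    coefficients : ∀ v → # (λ c → comb c == v) ≡ χ (S v)
    coefficients v with true-or-false (S v)
    ... | inj₁ Sv rewrite Sv with proj₁ (h v) Sv
    ...   | c , e = #-singleton (Vec.tabulate c) (dec-true (Vecₚ.≡-dec Finₚ._≟_ _ v) hit)
            (λ d e′ → lookup-ext d _ (lin-injective ind _ _ (trans (==⇒≡ e′) (sym hit))))
      where
      hit : comb (Vec.tabulate c) ≡ v
      hit = trans (lin-cong b (Vecₚ.lookup∘tabulate c)) e
    coefficients v | inj₂ ¬Sv rewrite ¬Sv = trans (#-cong {Q = λ _ → false} (λ c → ≢⇒==false
      (λ e → true≢false (trans (sym (proj₂ (h v) (Vec.lookup c , e))) ¬Sv)))) (∑-zero C)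

  span⊆ : ∀ {n k} {S : Subset F n} → IsSubspace S → (b : Fin k → Vector F n) → (∀ i → S (b i) ≡ true) →
          ∀ v → span b v ≡ true → S v ≡ true
  span⊆ {S = S} hS b hb v h with span⁻ b h
  ... | c , e = subst (λ w → S w ≡ true) e (lin∈ hS b hb c)

  empty-independent : ∀ {n} → LinearlyIndependent F {n} VF.[]
  empty-independent c e ()

  extend-independent : ∀ {n k} (b : Fin k → Vector F n) → LinearlyIndependent F b →
                       ∀ {x} → span b x ≡ false → LinearlyIndependent F (x VF.∷ b)
  extend-independent b ind {x} x∉ c e with c Fin.zero Finₚ.≟ 0#
  ... | no c₀≢0 with inverse _ c₀≢0
  ...   | y , c₀y = ⊥-elim (true≢false (trans (sym (subst (λ w → span b w ≡ true) (sym (solve-for x (lin (c ∘ Fin.suc) b) c₀y e))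
            (•∈ (dim⇒subspace (span-dim b ind)) _ (span⁺ b (_ , refl))))) x∉))
  extend-independent b ind {x} x∉ c e | yes c₀≡0 = λ
    { Fin.zero    → c₀≡0
    ; (Fin.suc i) → ind (c ∘ Fin.suc) tail i }
    where
    tail : lin (c ∘ Fin.suc) b ≡ 0ᵥ
    tail = trans (sym (trans (cong (λ a → a • x ⊹ lin (c ∘ Fin.suc) b) c₀≡0)
      (trans (cong (_⊹ lin (c ∘ Fin.suc) b) (•-zeroˡ x)) (⊹-identityˡ _)))) e

  span-∷⁻ : ∀ {n k} {S : Subset F n} → IsSubspace S → (b : Fin k → Vector F n) → ∀ {x} →
            S x ≡ true → (∀ v → span b v ≡ true → S v ≡ true) → ∀ v → span (x VF.∷ b) v ≡ true → S v ≡ true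
  span-∷⁻ hS b {x} Sx h = span⊆ hS (x VF.∷ b) λ
    { Fin.zero    → Sx
    ; (Fin.suc i) → h _ (span⁺ b (basis∈span b i)) }

  head∈span : ∀ {n k} (b : Fin k → Vector F n) x → span (x VF.∷ b) x ≡ true
  head∈span b x = span⁺ (x VF.∷ b) (basis∈span (x VF.∷ b) Fin.zero)

  tail⊆span : ∀ {n k} (b : Fin k → Vector F n) {x} → LinearlyIndependent F (x VF.∷ b) →
              ∀ v → span b v ≡ true → span (x VF.∷ b) v ≡ true
  tail⊆span b {x} ind = span⊆ (dim⇒subspace (span-dim (x VF.∷ b) ind)) b (λ i → span⁺ (x VF.∷ b) (basis∈span (x VF.∷ b) (Fin.suc i)))

  -- B is cut out of W by one functional a, so B ∩ B′ ⊇ B′ ∩ ker a.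
  hyperplanes-meet : ∀ {n m} {W B B′ : Subset F n} → IsSubspace W → IsSubspace B → IsSubspace B′ →
    # W ≡ q ^ suc (suc m) → # B ≡ q ^ suc m → # B′ ≡ q ^ suc m →
    (∀ v → B v ≡ true → W v ≡ true) → (∀ v → B′ v ≡ true → W v ≡ true) → q ^ m ≤ # (B ∩ B′)
  hyperplanes-meet {n} {m} {W} {B} {B′} hW hB hB′ #W #B #B′ B⊆W B′⊆W with #<⇒∃ {P = perp B} {Q = perp W} perp-lt
    where
    0<q^ : ∀ k → 0 < q ^ k
    0<q^ k = m^n>0 q {{>-nonZero (<-trans (s≤s z≤n) 1<q)}} k
    -- The smaller space has the larger complement, since the two sizes multiply to q^n. The gap
    -- supplies a functional that is zero on B but not on W.
    perp-lt : # (perp W) < # (perp B)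
    perp-lt = ≰⇒> λ le → <-irrefl refl (begin-strict
      q ^ n                              ≡⟨ sym (#-perp hB) ⟩
      # (perp B) * # B                   ≡⟨ cong (# (perp B) *_) #B ⟩
      # (perp B) * q ^ suc m             ≤⟨ *-monoˡ-≤ (q ^ suc m) le ⟩
      # (perp W) * q ^ suc m             <⟨ *-monoʳ-< (# (perp W)) {{>-nonZero perpW-pos}} (^-monoʳ-< q 1<q (n<1+n (suc m))) ⟩
      # (perp W) * q ^ suc (suc m)       ≡⟨ cong (# (perp W) *_) (sym #W) ⟩
      # (perp W) * # W                   ≡⟨ #-perp hW ⟩
      q ^ n                              ∎)
      where
      open ≤-Reasoning
      perpW-pos : 0 < # (perp W)
      perpW-pos with # (perp W) in eq
      ... | suc _ = s≤s z≤n
      ... | zero  = ⊥-elim (<-irrefl (trans (sym (cong (_* # W) eq)) (#-perp hW)) (0<q^ n))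
  ... | a , a⊥B , ¬a⊥W = ≤-trans B′∩ker (#-mono {P = B′ ∩ ker a} λ v h →
          ∧-intro (ker⇒B v (∧-intro (B′⊆W v (∧-elimˡ h)) (∧-elimʳ {B′ v} h))) (∧-elimˡ h))
    where
    q≢0 = >-nonZero (<-trans (s≤s z≤n) 1<q)
    W∩ker : # (W ∩ ker a) ≡ q ^ suc m
    W∩ker with #-ker-or-perp hW a
    ... | inj₁ (h , _) = ⊥-elim (true≢false (trans (sym h) ¬a⊥W))
    ... | inj₂ (_ , e) = *-cancelˡ-≡ _ _ q {{q≢0}} (trans e #W)
    ker⇒B : ∀ v → (W ∩ ker a) v ≡ true → B v ≡ true
    ker⇒B = ⊆-antisym-# (λ v Bv → ∧-intro (B⊆W v Bv) (⊆⁻ {P = B} a⊥B v Bv)) (≤-reflexive (trans W∩ker (sym #B)))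
    B′∩ker : q ^ m ≤ # (B′ ∩ ker a)
    B′∩ker with #-ker-or-perp hB′ a
    ... | inj₁ (_ , e) = ≤-trans (^-monoʳ-≤ q {{q≢0}} (n≤1+n m)) (≤-reflexive (sym (trans e #B′)))
    ... | inj₂ (_ , e) = ≤-reflexive (sym (*-cancelˡ-≡ _ _ q {{q≢0}} (trans e #B′)))

-- Intersection numbers of the given design

-- d is a variable rather than the literal 7 so that the enumeration of all vectors does not unfold.
module DesignCounts {q d : ℕ} (d≡7 : d ≡ 7) (F : FiniteField q) (D : SubspaceDesign F 2 d 3 1) where
  open LinearAlgebra F
  open SubspaceDesign D

  private
    V = allVectors q d
    I = allFin numBlocks
    b = ∑ I (λ _ → 1)
    r = q ^ 4 + q ^ 2 + 1
    instance
      q≢0 = >-nonZero (<-trans (s≤s z≤n) 1<q)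

  #-full₇ : # (full {d}) ≡ q ^ 7
  #-full₇ = trans (#-full d) (cong (q ^_) d≡7)

  #-perp₇ : ∀ {U : Subset F d} → IsSubspace U → # (perp U) * # U ≡ q ^ 7
  #-perp₇ hU = trans (#-perp hU) (cong (q ^_) d≡7)

  block-subspace : ∀ i → IsSubspace (block i)
  block-subspace i = dim⇒subspace (blockDim i)

  #-block : ∀ i → # (block i) ≡ q ^ 3
  #-block i = #-dim (blockDim i)

  line : Vector F d → Subset F d
  line x = span (x VF.∷ VF.[])

  line-independent : ∀ {x : Vector F d} → x ≢ 0ᵥ → LinearlyIndependent F (x VF.∷ VF.[])
  line-independent {x} x≢0 = extend-independent VF.[] empty-independent
    (not-true⇒false {span VF.[] x} (λ h → x≢0 (sym (proj₂ (span⁻ VF.[] h)))))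

  line⊆ : ∀ {S : Subset F d} → IsSubspace S → ∀ {x} → S x ≡ true → ∀ y → line x y ≡ true → S y ≡ true
  line⊆ hS {x} Sx = span⊆ hS (x VF.∷ VF.[]) λ { Fin.zero → Sx }

  #-line : ∀ {x : Vector F d} → x ≢ 0ᵥ → # (line x) ≡ q
  #-line x≢0 = trans (#-dim (span-dim (_ VF.∷ VF.[]) (line-independent x≢0))) (*-identityʳ q)

  degree : Vector F d → ℕ
  degree x = ∑ I (λ i → χ (block i x))

  joint : Vector F d → Vector F d → ℕ
  joint x y = ∑ I (λ i → χ (block i x) * χ (block i y))

  -- A block contains both vectors exactly when it contains the plane they span, and λ is 1 for that
  -- plane.
  joint-independent : ∀ {x y : Vector F d} → x ≢ 0ᵥ → line x y ≡ false → joint x y ≡ 1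
  joint-independent {x} {y} x≢0 y∉ = begin
    joint x y                                            ≡⟨ ∑-cong I (λ i → trans (sym (χ-∧ (block i x) (block i y))) (cong χ (contains i))) ⟩
    ∑ I (λ i → χ (plane ⊆ block i))                      ≡⟨ ∑-tabulate id (λ i → plane ⊆ block i) ⟩
    countFin numBlocks (λ i → plane ⊆ᵇ block i)          ≡⟨ balanced plane (span-dim basis ind) ⟩
    1                                                    ∎
    where
    open ≡-Reasoning
    basis = y VF.∷ x VF.∷ VF.[]
    plane = span basis
    ind : LinearlyIndependent F basis
    ind = extend-independent (x VF.∷ VF.[]) (line-independent x≢0) y∉
    contains : ∀ i → block i x ∧ block i y ≡ plane ⊆ block i
    contains i = Bool-ext
      (λ h → ⊆⁺ {P = plane} (span⊆ (block-subspace i) basis λ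
        { Fin.zero           → ∧-elimʳ {block i x} h
        ; (Fin.suc Fin.zero) → ∧-elimˡ h }))
      (λ h → ∧-intro (⊆⁻ {P = plane} h x (span⁺ basis (basis∈span basis (Fin.suc Fin.zero))))
                     (⊆⁻ {P = plane} h y (span⁺ basis (basis∈span basis Fin.zero))))

  -- The q multiples of x lie in every block through x and contribute `degree x` each; every other
  -- vector of H is independent of x and contributes 1.
  row : ∀ {H} → IsSubspace H → ∀ {x : Vector F d} → x ≢ 0ᵥ → H x ≡ true →
        ∑ V (λ y → χ (H y) * joint x y) + q ≡ q * degree x + # H
  row {H} hH {x} x≢0 Hx = begin
    ∑ V (λ y → χ (H y) * joint x y) + q                    ≡⟨ cong (∑ V (λ y → χ (H y) * joint x y) +_) (sym (#-line x≢0)) ⟩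
    ∑ V (λ y → χ (H y) * joint x y) + # (line x)           ≡⟨ sym (∑-+ V _ _) ⟩
    ∑ V (λ y → χ (H y) * joint x y + χ (line x y))         ≡⟨ ∑-cong V pointwise ⟩
    ∑ V (λ y → χ (line x y) * degree x + χ (H y))          ≡⟨ ∑-+ V _ _ ⟩
    ∑ V (λ y → χ (line x y) * degree x) + # H              ≡⟨ cong (_+ # H) (∑-*ʳ V (degree x) _) ⟩
    # (line x) * degree x + # H                            ≡⟨ cong (λ l → l * degree x + # H) (#-line x≢0) ⟩
    q * degree x + # H                                     ∎
    where
    open ≡-Reasoning
    joint-line : ∀ y → line x y ≡ true → joint x y ≡ degree x
    joint-line y y∈ = ∑-cong I (λ i → trans (sym (χ-∧ (block i x) (block i y))) (cong χ
      (Bool-ext {block i x ∧ block i y} ∧-elimˡ (λ Bx → ∧-intro Bx (line⊆ (block-subspace i) Bx y y∈)))))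
    pointwise : ∀ y → χ (H y) * joint x y + χ (line x y) ≡ χ (line x y) * degree x + χ (H y)
    pointwise y with true-or-false (line x y)
    ... | inj₁ y∈ rewrite y∈ | line⊆ hH Hx y y∈ | joint-line y y∈ = refl
    ... | inj₂ y∉ rewrite y∉ | joint-independent x≢0 y∉ = trans (+-identityʳ _) (*-identityʳ _)

  -- In the sum of `joint x y` over all y each block through x contributes q³, while `row` for the
  -- whole space evaluates the same sum. Hence (q³ - q) r = q⁷ - q.
  degree-nonzero : ∀ {x : Vector F d} → x ≢ 0ᵥ → degree x ≡ r
  degree-nonzero {x} x≢0 = solve-degree q 1<q (begin
    q ^ 3 * degree x + q
      ≡⟨ cong (_+ q) (sym total) ⟩
    ∑ V (λ y → 1 * joint x y) + q
      ≡⟨ row full-isSubspace x≢0 refl ⟩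
    q * degree x + # (full {d})
      ≡⟨ cong (q * degree x +_) #-full₇ ⟩
    q * degree x + q ^ 7 ∎)
    where
    open ≡-Reasoning
    total : ∑ V (λ y → 1 * joint x y) ≡ q ^ 3 * degree x
    total = begin
      ∑ V (λ y → 1 * joint x y)                                ≡⟨ ∑-cong V (λ y → *-identityˡ _) ⟩
      ∑ V (λ y → joint x y)                                    ≡⟨ ∑-swap V I _ ⟩
      ∑ I (λ i → ∑ V (λ y → χ (block i x) * χ (block i y)))    ≡⟨ ∑-cong I (λ i → ∑-*ˡ V (χ (block i x)) _) ⟩
      ∑ I (λ i → χ (block i x) * # (block i))                  ≡⟨ ∑-cong I (λ i → cong (χ (block i x) *_) (#-block i)) ⟩
      ∑ I (λ i → χ (block i x) * q ^ 3)                        ≡⟨ ∑-*ʳ I (q ^ 3) _ ⟩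
      degree x * q ^ 3                                         ≡⟨ *-comm (degree x) (q ^ 3) ⟩
      q ^ 3 * degree x                                         ∎

  degree-zero : degree 0ᵥ ≡ b
  degree-zero = ∑-cong I (λ i → cong χ (0∈ (block-subspace i)))

  joint-zero : ∀ y → joint 0ᵥ y ≡ degree y
  joint-zero y = ∑-cong I (λ i → trans (cong (λ z → χ z * χ (block i y)) (0∈ (block-subspace i))) (*-identityˡ _))

  -- Moments of the section sizes with a subspace

  module _ {H : Subset F d} (hH : IsSubspace H) where
    open ≡-Reasoning

    Y₁ Y₂ : ℕ
    Y₁ = ∑ I (λ i → # (H ∩ block i))
    Y₂ = ∑ I (λ i → # (H ∩ block i) * # (H ∩ block i))

    Y₁-swap : Y₁ ≡ ∑ V (λ x → χ (H x) * degree x)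
    Y₁-swap = trans (∑-swap I V _) (∑-cong V (λ x → trans
      (∑-cong I (λ i → χ-∧ (H x) (block i x))) (∑-*ˡ I (χ (H x)) _)))

    Y₂-swap : Y₂ ≡ ∑ V (λ x → χ (H x) * ∑ V (λ y → χ (H y) * joint x y))
    Y₂-swap = begin
      ∑ I (λ i → # (H ∩ block i) * # (H ∩ block i))
        ≡⟨ ∑-cong I (λ i → sym (∑-*ʳ V (# (H ∩ block i)) _)) ⟩
      ∑ I (λ i → ∑ V (λ x → χ (H x ∧ block i x) * # (H ∩ block i)))
        ≡⟨ ∑-swap I V _ ⟩
      ∑ V (λ x → ∑ I (λ i → χ (H x ∧ block i x) * # (H ∩ block i)))
        ≡⟨ ∑-cong V inner ⟩
      ∑ V (λ x → χ (H x) * ∑ V (λ y → χ (H y) * joint x y)) ∎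
      where
      shuffle : ∀ a b c d → (a * b) * (c * d) ≡ a * (c * (b * d))
      shuffle = solve 4 (λ a b c d → (a :* b) :* (c :* d) := a :* (c :* (b :* d))) refl
        where open +-*-Solver
      inner : ∀ x → ∑ I (λ i → χ (H x ∧ block i x) * # (H ∩ block i)) ≡ χ (H x) * ∑ V (λ y → χ (H y) * joint x y)
      inner x = begin
        ∑ I (λ i → χ (H x ∧ block i x) * # (H ∩ block i))
          ≡⟨ ∑-cong I (λ i → sym (∑-*ˡ V (χ (H x ∧ block i x)) _)) ⟩
        ∑ I (λ i → ∑ V (λ y → χ (H x ∧ block i x) * χ (H y ∧ block i y)))
          ≡⟨ ∑-cong I (λ i → ∑-cong V (λ y → trans (cong₂ _*_ (χ-∧ (H x) (block i x)) (χ-∧ (H y) (block i y)))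
               (shuffle (χ (H x)) (χ (block i x)) (χ (H y)) (χ (block i y))))) ⟩
        ∑ I (λ i → ∑ V (λ y → χ (H x) * (χ (H y) * (χ (block i x) * χ (block i y)))))
          ≡⟨ ∑-swap I V _ ⟩
        ∑ V (λ y → ∑ I (λ i → χ (H x) * (χ (H y) * (χ (block i x) * χ (block i y)))))
          ≡⟨ ∑-cong V (λ y → trans (∑-*ˡ I (χ (H x)) _) (cong (χ (H x) *_) (∑-*ˡ I (χ (H y)) _))) ⟩
        ∑ V (λ y → χ (H x) * (χ (H y) * joint x y))
          ≡⟨ ∑-*ˡ V (χ (H x)) _ ⟩
        χ (H x) * ∑ V (λ y → χ (H y) * joint x y) ∎

    -- Zero lies in every block and is the one irregular vector. The value `c` expected there and
    -- the actual value `f 0ᵥ` are added on opposite sides.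
    ∑-off-zero : ∀ (f : Vector F d → ℕ) c → (∀ x → x ≢ 0ᵥ → H x ≡ true → f x ≡ c) →
                 ∑ V (λ x → χ (H x) * f x) + c ≡ # H * c + f 0ᵥ
    ∑-off-zero f c hf = begin
      ∑ V (λ x → χ (H x) * f x) + c
        ≡⟨ cong (∑ V (λ x → χ (H x) * f x) +_) (sym (∑-point (0ᵥ {d}) (λ _ → c))) ⟩
      ∑ V (λ x → χ (H x) * f x) + ∑ V (λ x → χ (x == 0ᵥ) * c)
        ≡⟨ sym (∑-+ V _ _) ⟩
      ∑ V (λ x → χ (H x) * f x + χ (x == 0ᵥ) * c)
        ≡⟨ ∑-cong V pointwise ⟩
      ∑ V (λ x → χ (H x) * c + χ (x == 0ᵥ) * f x)
        ≡⟨ ∑-+ V _ _ ⟩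
      ∑ V (λ x → χ (H x) * c) + ∑ V (λ x → χ (x == 0ᵥ) * f x)
        ≡⟨ cong₂ _+_ (∑-*ʳ V c _) (∑-point 0ᵥ f) ⟩
      # H * c + f 0ᵥ ∎
      where
      pointwise : ∀ x → χ (H x) * f x + χ (x == 0ᵥ) * c ≡ χ (H x) * c + χ (x == 0ᵥ) * f x
      pointwise x with true-or-false (x == 0ᵥ)
      ... | inj₁ e rewrite e | trans (cong H (==⇒≡ {x = x} e)) (0∈ hH) = +-comm (1 * f x) (1 * c)
      ... | inj₂ e rewrite e with true-or-false (H x)
      ...   | inj₁ Hx rewrite Hx = cong (λ z → 1 * z + 0)
                (hf x (λ z → true≢false (trans (sym (trans (cong (_== 0ᵥ) z) (==-refl (0ᵥ {d})))) e)) Hx)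
      ...   | inj₂ Hx rewrite Hx = refl

    -- Used for two subspaces: for the whole space, where every section has q³ vectors, it yields
    -- the number of blocks; for T^⊥ it is the first moment proper.
    moment₁ : Y₁ + r ≡ # H * r + b
    moment₁ = begin
      Y₁ + r                                  ≡⟨ cong (_+ r) Y₁-swap ⟩
      ∑ V (λ x → χ (H x) * degree x) + r      ≡⟨ ∑-off-zero degree r (λ x x≢0 _ → degree-nonzero x≢0) ⟩
      # H * r + degree 0ᵥ                     ≡⟨ cong (# H * r +_) degree-zero ⟩
      # H * r + b                             ∎

    -- `row` is summed over H with its summand q carried along for each vector, which produces
    -- `# H * q`. The zero vector contributes Y₁, since `joint 0ᵥ y` is `degree y`.
    moment₂ : Y₂ + (# H * q + (q * r + # H)) ≡ # H * (q * r + # H) + (Y₁ + q)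
    moment₂ = begin
      Y₂ + (# H * q + c)                                    ≡⟨ sym (+-assoc Y₂ _ c) ⟩
      Y₂ + # H * q + c                                      ≡⟨ cong (λ z → z + c) shift ⟩
      ∑ V (λ x → χ (H x) * (f x + q)) + c                   ≡⟨ ∑-off-zero (λ x → f x + q) c (λ x x≢0 Hx →
                                                                 trans (row hH x≢0 Hx) (cong (λ d → q * d + # H) (degree-nonzero x≢0))) ⟩
      # H * c + (f 0ᵥ + q)                                  ≡⟨ cong (λ z → # H * c + (z + q)) at-zero ⟩
      # H * c + (Y₁ + q)                                    ∎
      where
      c = q * r + # H
      f = λ x → ∑ V (λ y → χ (H y) * joint x y)
      at-zero : f 0ᵥ ≡ Y₁
      at-zero = trans (∑-cong V (λ y → cong (χ (H y) *_) (joint-zero y))) (sym Y₁-swap)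
      shift : Y₂ + # H * q ≡ ∑ V (λ x → χ (H x) * (f x + q))
      shift = begin
        Y₂ + # H * q                                              ≡⟨ cong₂ _+_ Y₂-swap (sym (∑-*ʳ V q _)) ⟩
        ∑ V (λ x → χ (H x) * f x) + ∑ V (λ x → χ (H x) * q)       ≡⟨ sym (∑-+ V _ _) ⟩
        ∑ V (λ x → χ (H x) * f x + χ (H x) * q)                   ≡⟨ ∑-cong V (λ x → sym (*-distribˡ-+ (χ (H x)) (f x) q)) ⟩
        ∑ V (λ x → χ (H x) * (f x + q))                           ∎

  block-count : q ^ 3 * b + r ≡ q ^ 7 * r + b
  block-count = begin
    q ^ 3 * b + r                      ≡⟨ cong (_+ r) (sym (∑-*ˡ I (q ^ 3) _)) ⟩
    ∑ I (λ _ → q ^ 3 * 1) + r          ≡⟨ cong (_+ r) (∑-cong I (λ i → trans (*-identityʳ _) (sym (#-block i)))) ⟩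
    Y₁ full-isSubspace + r             ≡⟨ moment₁ full-isSubspace ⟩
    # (full {d}) * r + b               ≡⟨ cong (λ z → z * r + b) #-full₇ ⟩
    q ^ 7 * r + b                      ∎
    where open ≡-Reasoning

  -- Blocks orthogonal to a 2-dimensional subspace

  module _ {T : Subset F d} (dimT : IsSubspaceOfDim F 2 T) where
    t : Fin 2 → Vector F d
    t = proj₁ dimT

    t-independent : LinearlyIndependent F t
    t-independent = proj₁ (proj₂ dimT)

    t∈T : ∀ i → T (t i) ≡ true
    t∈T i = proj₂ (proj₂ (proj₂ dimT) _) (basis∈span t i)

    span-t : ∀ v → span t v ≡ T v
    span-t v = Bool-ext (λ h → proj₂ (proj₂ (proj₂ dimT) v) (span⁻ t h)) (λ h → span⁺ t (proj₁ (proj₂ (proj₂ dimT) v) h))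

    T⊆ : ∀ {S} → IsSubspace S → S (t Fin.zero) ≡ true → S (t (Fin.suc Fin.zero)) ≡ true → ∀ v → T v ≡ true → S v ≡ true
    T⊆ hS h₀ h₁ v Tv = span⊆ hS t (λ { Fin.zero → h₀ ; (Fin.suc Fin.zero) → h₁ }) v (trans (span-t v) Tv)

    #-perp-T : # (perp T) ≡ q ^ 5
    #-perp-T = *-cancelʳ-≡ _ _ (q ^ 2) {{m^n≢0 q 2}}
      (trans (cong (# (perp T) *_) (sym (#-dim dimT))) (trans (#-perp₇ (dim⇒subspace dimT)) (^-distribˡ-+-* q 5 2)))

    orthogonal : Fin numBlocks → Bool
    orthogonal i = T ⊆ perp (block i)

    -- The section is cut out of the block by the two basis vectors of T, each of which keeps the
    -- size or divides it by q. It stays q³ exactly when both are orthogonal to the whole block.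
    section-size : ∀ i → let y = # (perp T ∩ block i) in
      (orthogonal i ≡ true × y ≡ q ^ 3) ⊎ (orthogonal i ≡ false × (y ≡ q ^ 2 ⊎ y ≡ q))
    section-size i with #-ker-or-perp (block-subspace i) t₀
                      | #-ker-or-perp (∩-isSubspace (block-subspace i) (ker-isSubspace t₀)) t₁
      where
      t₀ = t Fin.zero
      t₁ = t (Fin.suc Fin.zero)
    ... | p₀ | p₁ = cases p₀ p₁
      where
      B = block i
      t₀ = t Fin.zero
      t₁ = t (Fin.suc Fin.zero)
      y = # (perp T ∩ B)
      S₁ = B ∩ ker t₀
      S₂ = S₁ ∩ ker t₁
      y≡ : y ≡ # S₂
      y≡ = #-cong λ v → Bool-ext
        (λ h → let v⊥T = λ u Tu → trans (ker-comm u v) (⊆⁻ {P = T} (∧-elimˡ {perp T v} h) u Tu) in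
               ∧-intro (∧-intro (∧-elimʳ {perp T v} h) (v⊥T t₀ (t∈T _))) (v⊥T t₁ (t∈T _)))
        (λ h → ∧-intro (⊆⁺ {P = T} (T⊆ (ker-isSubspace v)
                  (trans (ker-comm v t₀) (∧-elimʳ {B v} (∧-elimˡ {S₁ v} h)))
                  (trans (ker-comm v t₁) (∧-elimʳ {S₁ v} h))))
                (∧-elimˡ {B v} (∧-elimˡ {S₁ v} h)))
      ¬⊥ : ∀ j → perp B (t j) ≡ false → orthogonal i ≡ false
      ¬⊥ j h = not-true⇒false (λ o → true≢false (trans (sym (⊆⁻ {P = T} o (t j) (t∈T j))) h))
      cases : (perp B t₀ ≡ true × # S₁ ≡ # B) ⊎ (perp B t₀ ≡ false × q * # S₁ ≡ # B) →
              (perp S₁ t₁ ≡ true × # S₂ ≡ # S₁) ⊎ (perp S₁ t₁ ≡ false × q * # S₂ ≡ # S₁) →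
              (orthogonal i ≡ true × y ≡ q ^ 3) ⊎ (orthogonal i ≡ false × (y ≡ q ^ 2 ⊎ y ≡ q))
      cases (inj₁ (h₀ , e₀)) (inj₁ (h₁ , e₁)) = inj₁
        ( ⊆⁺ {P = T} (T⊆ (perp-isSubspace B) h₀ (⊆⁺ {P = B} (λ u Bu → ⊆⁻ {P = S₁} h₁ u (∧-intro Bu (⊆⁻ {P = B} h₀ u Bu)))))
        , trans y≡ (trans e₁ (trans e₀ (#-block i))) )
      cases (inj₁ (h₀ , e₀)) (inj₂ (h₁ , e₁)) = inj₂
        ( ¬⊥ (Fin.suc Fin.zero) (not-true⇒false (λ h → true≢false (trans (sym
            (⊆⁺ {P = S₁} {Q = ker t₁} (λ u h′ → ⊆⁻ {P = B} h u (∧-elimˡ h′)))) h₁)))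
        , inj₁ (trans y≡ (*-cancelˡ-≡ _ _ q (trans e₁ (trans e₀ (#-block i))))) )
      cases (inj₂ (h₀ , e₀)) (inj₁ (h₁ , e₁)) = inj₂
        ( ¬⊥ Fin.zero h₀ , inj₁ (trans y≡ (*-cancelˡ-≡ _ _ q (trans (cong (q *_) e₁) (trans e₀ (#-block i))))) )
      cases (inj₂ (h₀ , e₀)) (inj₂ (h₁ , e₁)) = inj₂
        ( ¬⊥ Fin.zero h₀ , inj₂ (trans y≡ (trans (*-cancelˡ-≡ _ _ q (*-cancelˡ-≡ _ _ q
            (trans (cong (q *_) e₁) (trans e₀ (#-block i))))) (*-identityʳ q))) )

    -- Summing (y - q)(y - q²) over the sections isolates the multiplicity of q³: the value there is
    -- (q³ - q)(q³ - q²) = q⁶ + q³ - (q⁵ + q⁴), the origin of these two coefficients.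
    #-orthogonal : ∑ I (χ ∘ orthogonal) ≡ q ^ 2 + 1
    #-orthogonal = solve-moments q 1<q block-count
      (subst (λ h → Y₁ hH + r ≡ h * r + b) #-perp-T (moment₁ hH))
      (subst (λ h → Y₂ hH + (h * q + (q * r + h)) ≡ h * (q * r + h) + (Y₁ hH + q)) #-perp-T (moment₂ hH))
      quadratic
      where
      open ≡-Reasoning
      hH = perp-isSubspace T
      n = ∑ I (χ ∘ orthogonal)
      y = λ i → # (perp T ∩ block i)
      -- (y - q) (y - q²) vanishes unless the block is orthogonal to T.
      pointwise : ∀ i → y i * y i + q ^ 3 * 1 + χ (orthogonal i) * (q ^ 5 + q ^ 4) ≡
                        (q + q ^ 2) * y i + χ (orthogonal i) * (q ^ 6 + q ^ 3)
      pointwise i with section-size i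
      ... | inj₁ (o , e) rewrite o | e = solve 1 (λ q →
              q :^ 3 :* q :^ 3 :+ q :^ 3 :* con 1 :+ con 1 :* (q :^ 5 :+ q :^ 4) :=
              (q :+ q :^ 2) :* q :^ 3 :+ con 1 :* (q :^ 6 :+ q :^ 3)) refl q
              where open +-*-Solver
      ... | inj₂ (o , inj₁ e) rewrite o | e = solve 1 (λ q →
              q :^ 2 :* q :^ 2 :+ q :^ 3 :* con 1 :+ con 0 := (q :+ q :^ 2) :* q :^ 2 :+ con 0) refl q
              where open +-*-Solver
      ... | inj₂ (o , inj₂ e) rewrite o | e = solve 1 (λ q →
              q :* q :+ q :^ 3 :* con 1 :+ con 0 := (q :+ q :^ 2) :* q :+ con 0) refl q
              where open +-*-Solver
      quadratic : Y₂ hH + q ^ 3 * b + n * (q ^ 5 + q ^ 4) ≡ (q + q ^ 2) * Y₁ hH + n * (q ^ 6 + q ^ 3)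
      quadratic = begin
        Y₂ hH + q ^ 3 * b + n * (q ^ 5 + q ^ 4)
          ≡⟨ cong₂ (λ a c → Y₂ hH + a + c) (sym (∑-*ˡ I (q ^ 3) _)) (sym (∑-*ʳ I _ _)) ⟩
        ∑ I (λ i → y i * y i) + ∑ I (λ i → q ^ 3 * 1) + ∑ I (λ i → χ (orthogonal i) * (q ^ 5 + q ^ 4))
          ≡⟨ trans (cong (_+ ∑ I (λ i → χ (orthogonal i) * (q ^ 5 + q ^ 4))) (sym (∑-+ I _ _))) (sym (∑-+ I _ _)) ⟩
        ∑ I (λ i → y i * y i + q ^ 3 * 1 + χ (orthogonal i) * (q ^ 5 + q ^ 4))
          ≡⟨ ∑-cong I pointwise ⟩
        ∑ I (λ i → (q + q ^ 2) * y i + χ (orthogonal i) * (q ^ 6 + q ^ 3))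
          ≡⟨ ∑-+ I _ _ ⟩
        ∑ I (λ i → (q + q ^ 2) * y i) + ∑ I (λ i → χ (orthogonal i) * (q ^ 6 + q ^ 3))
          ≡⟨ cong₂ _+_ (∑-*ˡ I (q + q ^ 2) _) (∑-*ʳ I (q ^ 6 + q ^ 3) _) ⟩
        (q + q ^ 2) * Y₁ hH + n * (q ^ 6 + q ^ 3) ∎

-- Removing repetitions from a list

any⁺ : ∀ {A : Set} (p : A → Bool) {x xs} → x ∈ xs → p x ≡ true → any p xs ≡ true
any⁺ p {xs = y ∷ ys} (here refl) px rewrite px = refl
any⁺ p {xs = y ∷ ys} (there x∈)  px rewrite any⁺ p x∈ px = Boolₚ.∨-zeroʳ (p y)

any-mono : ∀ {A : Set} {p p′ : A → Bool} xs → (∀ x → p x ≡ true → p′ x ≡ true) → any p xs ≡ true → any p′ xs ≡ true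
any-mono {p = p} (x ∷ xs) h e with true-or-false (p x)
... | inj₁ px rewrite h x px = refl
... | inj₂ ¬px rewrite ¬px | any-mono xs h e = Boolₚ.∨-zeroʳ _

module Representatives {A : Set} (_≈_ : A → A → Bool)
  (≈-sym : ∀ {x y} → x ≈ y ≡ true → y ≈ x ≡ true)
  (≈-trans : ∀ {x y z} → x ≈ y ≡ true → y ≈ z ≡ true → x ≈ z ≡ true) where

  representatives : List A → List A
  representatives []       = []
  representatives (x ∷ xs) = if any (_≈ x) xs then representatives xs else x ∷ representatives xs

  -- One equation for two facts: no class is represented twice, and every class that occurs in the
  -- list is represented.
  ∑-representatives : ∀ xs y → ∑ (representatives xs) (λ x → χ (x ≈ y)) ≡ χ (any (_≈ y) xs)
  ∑-representatives []       y = refl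
  ∑-representatives (x ∷ xs) y with true-or-false (any (_≈ x) xs) | true-or-false (x ≈ y)
  ... | inj₁ h | inj₁ e rewrite h | e | ∑-representatives xs y =
        cong χ (any-mono xs (λ z z≈x → ≈-trans z≈x e) h)
  ... | inj₁ h | inj₂ e rewrite h | e = ∑-representatives xs y
  ... | inj₂ h | inj₂ e rewrite h | e = ∑-representatives xs y
  ... | inj₂ h | inj₁ e rewrite h | e = cong suc (trans (∑-representatives xs y) (cong χ (not-true⇒false
        (λ a → true≢false (trans (sym (any-mono xs (λ z z≈y → ≈-trans z≈y (≈-sym e)) a)) h)))))

  All-representatives : ∀ {P : A → Set} {xs} → All P xs → All P (representatives xs)
  All-representatives [] = []
  All-representatives {xs = x ∷ xs} (px ∷ pxs) with any (_≈ x) xs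
  ... | true  = All-representatives pxs
  ... | false = px ∷ All-representatives pxs

-- The new design

module Construction {q d : ℕ} (d≡7 : d ≡ 7) (F : FiniteField q) (D : SubspaceDesign F 2 d 3 1) where
  open LinearAlgebra F
  open SubspaceDesign D
  open DesignCounts d≡7 F D

  private
    V = allVectors q d
    I = allFin numBlocks
    module I = Counting (finite-Fin numBlocks)

  -- By symmetry of the form, K ⊆ B^⊥ says that B lies in K^⊥. In this form the test for K = ⟨T , x⟩
  -- splits into T ⊆ B^⊥ and x ∈ B^⊥.
  avoids : Subset F d → Bool
  avoids K = I.every (λ i → not (K ⊆ perp (block i)))

  perp-sym : ∀ {n} {S U : Subset F n} → (∀ x → S x ≡ true → perp U x ≡ true) → ∀ x → U x ≡ true → perp S x ≡ true
  perp-sym {S = S} {U} h x Ux = ⊆⁺ {P = S} (λ u Su → trans (ker-comm x u) (⊆⁻ {P = U} (h u Su) x Ux))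

  ⊆-congˡ : ∀ {n} {S S′ : Subset F n} U → (∀ v → S v ≡ S′ v) → S ⊆ U ≡ S′ ⊆ U
  ⊆-congˡ {S = S} {S′} U h = Bool-ext
    (λ e → ⊆⁺ {P = S′} (λ v S′v → ⊆⁻ {P = S} e v (trans (h v) S′v)))
    (λ e → ⊆⁺ {P = S} (λ v Sv → ⊆⁻ {P = S′} e v (trans (sym (h v)) Sv)))

  avoids-cong : ∀ {K K′} → (∀ v → K v ≡ K′ v) → avoids K ≡ true → avoids K′ ≡ true
  avoids-cong {K} {K′} h a = I.every⁺ (λ i → trans (cong not (sym (⊆-congˡ {S = K} {K′} (perp (block i)) h))) (I.every⁻ a i))

  #-perp-dim3 : ∀ {K} → IsSubspace K → # K ≡ q ^ 3 → # (perp K) ≡ q ^ 4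
  #-perp-dim3 {K} hK #K = *-cancelʳ-≡ _ _ (q ^ 3) {{m^n≢0 q 3 {{>-nonZero (<-trans (s≤s z≤n) 1<q)}}}}
    (trans (cong (# (perp K) *_) (sym #K)) (trans (#-perp₇ hK) (^-distribˡ-+-* q 4 3)))

  -- Two such blocks would lie in the 4-dimensional K^⊥ and hence share a 2-dimensional subspace.
  orthogonal-block-unique : ∀ {K} → IsSubspaceOfDim F 3 K → ∀ i j →
    K ⊆ perp (block i) ≡ true → K ⊆ perp (block j) ≡ true → i ≡ j
  orthogonal-block-unique {K} dimK i j K⊥i K⊥j = go (#<⇒∃ {P = block i ∩ block j} {Q = span VF.[]} 1<meet)
    where
    meet : q ^ 2 ≤ # (block i ∩ block j)
    meet = hyperplanes-meet {m = 2} (perp-isSubspace K) (block-subspace i) (block-subspace j)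
      (#-perp-dim3 (dim⇒subspace dimK) (#-dim dimK)) (#-block i) (#-block j)
      (perp-sym {S = K} (⊆⁻ {P = K} K⊥i)) (perp-sym {S = K} (⊆⁻ {P = K} K⊥j))
    1<meet : # (span {d} VF.[]) < # (block i ∩ block j)
    1<meet = <-≤-trans (subst (_< q ^ 2) (sym (#-dim (span-dim {d} VF.[] empty-independent))) (^-monoʳ-< q 1<q {0} {2} (s≤s z≤n))) meet
    -- The intersection has at least q² vectors: more than 1, so some u in it is nonzero, and more
    -- than q, so some w in it is not a multiple of u. Only one block contains both.
    go : (∃ λ u → (block i ∩ block j) u ≡ true × span VF.[] u ≡ false) → i ≡ j
    go (u , u∈ , u∉0) = go′ (#<⇒∃ {P = block i ∩ block j} {Q = line u} q<meet)
      where
      u≢0 : u ≢ 0ᵥ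
      u≢0 u≡0 = true≢false (trans (sym (span⁺ VF.[] ((λ ()) , sym u≡0))) u∉0)
      q<meet : # (line u) < # (block i ∩ block j)
      q<meet = <-≤-trans (subst₂ _<_ (trans (*-identityʳ q) (sym (#-line u≢0))) refl (^-monoʳ-< q 1<q {1} {2} (s≤s (s≤s z≤n)))) meet
      go′ : (∃ λ w → (block i ∩ block j) w ≡ true × line u w ≡ false) → i ≡ j
      go′ (w , w∈ , w∉) = I.#≤1⇒unique {P = λ k → block k u ∧ block k w}
        (≤-reflexive (trans (∑-cong I (λ k → χ-∧ (block k u) (block k w))) (joint-independent u≢0 w∉))) i j
        (∧-intro (∧-elimˡ {block i u} u∈) (∧-elimˡ {block i w} w∈))
        (∧-intro (∧-elimʳ {block i u} u∈) (∧-elimʳ {block i w} w∈))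

  -- By uniqueness the number of old blocks orthogonal to K is 0 or 1, and it is 0 exactly when K is
  -- new. This complementarity reduces counting new blocks to counting old ones.
  χ-avoids : ∀ {K} → IsSubspaceOfDim F 3 K → χ (avoids K) + I.# (λ i → K ⊆ perp (block i)) ≡ 1
  χ-avoids {K} dimK with true-or-false (avoids K)
  ... | inj₁ a rewrite a = cong suc (trans (I.#-cong {Q = λ _ → false} (λ i →
        trans (sym (Boolₚ.not-involutive _)) (cong not (I.every⁻ a i)))) (∑-zero I))
  ... | inj₂ a rewrite a with I.every-false a
  ...   | i , e = I.#-singleton i K⊥i (λ j K⊥j → orthogonal-block-unique dimK j i K⊥j K⊥i)
    where
    K⊥i : K ⊆ perp (block i) ≡ true
    K⊥i = trans (sym (Boolₚ.not-involutive _)) (cong not e)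

  #-outside : ∀ {T S : Subset F d} → (∀ v → T v ≡ true → S v ≡ true) →
              ∑ V (λ x → χ (not (T x)) * χ (S x)) + # T ≡ # S
  #-outside {T} {S} T⊆S = trans (sym (∑-+ V _ _)) (∑-cong V pointwise)
    where
    pointwise : ∀ x → χ (not (T x)) * χ (S x) + χ (T x) ≡ χ (S x)
    pointwise x with true-or-false (T x)
    ... | inj₁ Tx rewrite Tx | T⊆S x Tx = refl
    ... | inj₂ Tx rewrite Tx = trans (+-identityʳ _) (*-identityˡ _)

  -- Counts pairs of an index and a vector outside T. It serves both the new blocks through T, of
  -- size q³, and the complements of old blocks orthogonal to T, of size q⁴.
  double-count-outside : ∀ {A : Set} (J : List A) (w : A → Bool) (C : A → Subset F d) (T : Subset F d) s →
    (∀ k → w k ≡ true → (∀ v → T v ≡ true → C k v ≡ true) × # (C k) ≡ s) →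
    ∑ V (λ x → χ (not (T x)) * ∑ J (λ k → χ (w k) * χ (C k x))) + ∑ J (χ ∘ w) * # T ≡ ∑ J (χ ∘ w) * s
  double-count-outside J w C T s h = begin
    ∑ V (λ x → χ (not (T x)) * ∑ J (λ k → χ (w k) * χ (C k x))) + ∑ J (χ ∘ w) * # T
      ≡⟨ cong₂ _+_ exchange (sym (∑-*ʳ J (# T) _)) ⟩
    ∑ J (λ k → χ (w k) * outside k) + ∑ J (λ k → χ (w k) * # T)
      ≡⟨ sym (∑-+ J _ _) ⟩
    ∑ J (λ k → χ (w k) * outside k + χ (w k) * # T)
      ≡⟨ ∑-cong J pointwise ⟩
    ∑ J (λ k → χ (w k) * s)
      ≡⟨ ∑-*ʳ J s _ ⟩
    ∑ J (χ ∘ w) * s ∎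
    where
    open ≡-Reasoning
    outside = λ k → ∑ V (λ x → χ (not (T x)) * χ (C k x))
    swap-factors : ∀ a b c → a * (b * c) ≡ b * (a * c)
    swap-factors = solve 3 (λ a b c → a :* (b :* c) := b :* (a :* c)) refl
      where open +-*-Solver
    exchange : ∑ V (λ x → χ (not (T x)) * ∑ J (λ k → χ (w k) * χ (C k x))) ≡ ∑ J (λ k → χ (w k) * outside k)
    exchange = begin
      ∑ V (λ x → χ (not (T x)) * ∑ J (λ k → χ (w k) * χ (C k x)))
        ≡⟨ ∑-cong V (λ x → sym (∑-*ˡ J (χ (not (T x))) _)) ⟩
      ∑ V (λ x → ∑ J (λ k → χ (not (T x)) * (χ (w k) * χ (C k x))))
        ≡⟨ ∑-swap V J _ ⟩
      ∑ J (λ k → ∑ V (λ x → χ (not (T x)) * (χ (w k) * χ (C k x))))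
        ≡⟨ ∑-cong J (λ k → trans (∑-cong V (λ x → swap-factors (χ (not (T x))) (χ (w k)) (χ (C k x)))) (∑-*ˡ V (χ (w k)) _)) ⟩
      ∑ J (λ k → χ (w k) * outside k) ∎
    pointwise : ∀ k → χ (w k) * outside k + χ (w k) * # T ≡ χ (w k) * s
    pointwise k with true-or-false (w k)
    ... | inj₂ e rewrite e = refl
    ... | inj₁ e rewrite e = trans (cong₂ _+_ (*-identityˡ (outside k)) (*-identityˡ (# T)))
          (trans (#-outside (proj₁ (h k e))) (trans (proj₂ (h k e)) (sym (*-identityˡ s))))

  -- A decision procedure for pointwise equality, the sense in which `distinct` compares blocks.
  _≐_ : Subset F d → Subset F d → Bool
  S ≐ U = (S ⊆ U) ∧ (U ⊆ S)

  ≐⁺ : ∀ {S U} → (∀ v → S v ≡ U v) → S ≐ U ≡ true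
  ≐⁺ {S} {U} h = ∧-intro (⊆⁺ {P = S} (λ v Sv → trans (sym (h v)) Sv)) (⊆⁺ {P = U} (λ v Uv → trans (h v) Uv))

  ≐⁻ : ∀ {S U} → S ≐ U ≡ true → ∀ v → S v ≡ U v
  ≐⁻ {S} {U} h v = Bool-ext (⊆⁻ {P = S} (∧-elimˡ h) v) (⊆⁻ {P = U} (∧-elimʳ {S ⊆ U} h) v)

  open Representatives _≐_
    (λ {S} {U} h → ≐⁺ (λ v → sym (≐⁻ {S} {U} h v)))
    (λ {S} {U} {W} h h′ → ≐⁺ (λ v → trans (≐⁻ {S} {U} h v) (≐⁻ {U} {W} h′ v)))

  Triple : Set
  Triple = Vector F d × Vector F d × Vector F d

  vectors : Triple → Fin 3 → Vector F d
  vectors (x , y , z) = x VF.∷ y VF.∷ z VF.∷ VF.[]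

  triples : List Triple
  triples = cartesianProduct V (cartesianProduct V V)

  ∈-V : ∀ x → x ∈ V
  ∈-V x = occurs V (≤-reflexive (sym (Finite.once (finite-Vec q d) x)))
    where
    occurs : ∀ xs → 0 < ∑ xs (λ y → χ (y == x)) → x ∈ xs
    occurs (y ∷ ys) pos with true-or-false (y == x)
    ... | inj₁ e = here (sym (==⇒≡ {x = y} e))
    ... | inj₂ e rewrite e = there (occurs ys pos)

  ∈-triples : ∀ t → t ∈ triples
  ∈-triples (x , y , z) = ∈ₚ.∈-cartesianProduct⁺ (∈-V x) (∈ₚ.∈-cartesianProduct⁺ (∈-V y) (∈-V z))

  independent : Triple → Bool
  independent t = (λ c → lin (Vec.lookup c) (vectors t) == 0ᵥ) ⊆ (_== 0ᵥ)

  independent⁻ : ∀ t → independent t ≡ true → LinearlyIndependent F (vectors t)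
  independent⁻ t h c e i = trans (sym (Vecₚ.lookup∘tabulate c i))
    (trans (cong (λ d → Vec.lookup d i) (==⇒≡ {x = Vec.tabulate c} {0ᵥ} (⊆⁻ {Q = _== 0ᵥ} h (Vec.tabulate c)
      (dec-true (Vecₚ.≡-dec Finₚ._≟_ _ _) (trans (lin-cong (vectors t) (Vecₚ.lookup∘tabulate c)) e)))))
      (Vecₚ.lookup-replicate i _))

  independent⁺ : ∀ t → LinearlyIndependent F (vectors t) → independent t ≡ true
  independent⁺ t ind = ⊆⁺ {Q = _== 0ᵥ} (λ c e → dec-true (Vecₚ.≡-dec Finₚ._≟_ c 0ᵥ)
    (lookup-ext c 0ᵥ (λ i → trans (ind (Vec.lookup c) (==⇒≡ e) i) (sym (Vecₚ.lookup-replicate i _)))))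

  suitable : Triple → Bool
  suitable t = independent t ∧ avoids (span (vectors t))

  -- Each new block appears once for every ordered basis, up to pointwise equality;
  -- `representatives` removes the repetitions.
  candidates : List (Subset F d)
  candidates = L.map (span ∘ vectors) (filter (λ t → suitable t Boolₚ.≟ true) triples)

  newBlocks : List (Subset F d)
  newBlocks = representatives candidates

  NewBlock : Subset F d → Set
  NewBlock K = IsSubspaceOfDim F 3 K × avoids K ≡ true

  All-newBlocks : All NewBlock newBlocks
  All-newBlocks = All-representatives (Allₚ.map⁺ (All.map
    (λ {t} h → span-dim (vectors t) (independent⁻ t (∧-elimˡ h)) , ∧-elimʳ {independent t} h)
    (Allₚ.all-filter (λ t → suitable t Boolₚ.≟ true) triples)))

  private
    J = allFin (length newBlocks)
    module J = Counting (finite-Fin (length newBlocks))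

  newBlock : Fin (length newBlocks) → Subset F d
  newBlock = lookup newBlocks

  newBlock-props : ∀ k → NewBlock (newBlock k)
  newBlock-props k = All.lookup All-newBlocks (∈ₚ.∈-lookup k)

  #-newBlock-≐ : ∀ K → J.# (λ k → newBlock k ≐ K) ≡ χ (any (_≐ K) candidates)
  #-newBlock-≐ K = trans (∑-tabulate id (λ k → newBlock k ≐ K))
    (trans (∑-lookup newBlocks (_≐ K)) (∑-representatives candidates K))

  newBlock-distinct : ∀ i j → i ≢ j → ¬ (∀ x → newBlock i x ≡ newBlock j x)
  newBlock-distinct i j i≢j e = i≢j (J.#≤1⇒unique {P = λ k → newBlock k ≐ newBlock j}
    (subst (_≤ 1) (sym (#-newBlock-≐ (newBlock j))) (χ-mono {b = true} (λ _ → refl))) i j (≐⁺ e) (≐⁺ {newBlock j} (λ _ → refl)))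

  module _ {T : Subset F d} (dimT : IsSubspaceOfDim F 2 T) where
    private
      b : Fin 2 → Vector F d
      b = t dimT

    module _ {x : Vector F d} (x∉T : T x ≡ false) where
      private
        K : Subset F d
        K = span (x VF.∷ b)

        ind : LinearlyIndependent F (x VF.∷ b)
        ind = extend-independent b (t-independent dimT) (trans (span-t dimT x) x∉T)

      extension-dim : IsSubspaceOfDim F 3 K
      extension-dim = span-dim (x VF.∷ b) ind

      extension⊆ : ∀ {S} → IsSubspace S → (T ⊆ S) ∧ S x ≡ K ⊆ S
      extension⊆ {S} hS = Bool-ext
        (λ h → ⊆⁺ {P = K} (span-∷⁻ hS b (∧-elimʳ {T ⊆ S} h) (λ v v∈ → ⊆⁻ {P = T} (∧-elimˡ h) v (trans (sym (span-t dimT v)) v∈))))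
        (λ h → ∧-intro (⊆⁺ {P = T} (λ v Tv → ⊆⁻ {P = K} h v (tail⊆span b ind v (trans (span-t dimT v) Tv))))
                       (⊆⁻ {P = K} h x (head∈span b x)))

      #-orthogonal-extension : ∑ I (λ i → χ (orthogonal dimT i) * χ (perp (block i) x)) ≡ I.# (λ i → K ⊆ perp (block i))
      #-orthogonal-extension = ∑-cong I (λ i → trans (sym (χ-∧ (orthogonal dimT i) (perp (block i) x)))
        (cong χ (extension⊆ (perp-isSubspace (block i)))))

      -- A new block containing T and x contains K and has the same size, hence equals K. Such a
      -- block is listed once if K is admissible and never otherwise.
      #-newBlocks-through : ∑ J (λ k → χ (T ⊆ newBlock k) * χ (newBlock k x)) ≡ χ (avoids K)
      #-newBlocks-through = begin
        ∑ J (λ k → χ (T ⊆ newBlock k) * χ (newBlock k x))   ≡⟨ ∑-cong J (λ k → trans (sym (χ-∧ (T ⊆ newBlock k) (newBlock k x))) (cong χ (trans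
                                                                 (extension⊆ (dim⇒subspace (proj₁ (newBlock-props k)))) (same k)))) ⟩
        J.# (λ k → newBlock k ≐ K)                          ≡⟨ count ⟩
        χ (avoids K)                                        ∎
        where
        open ≡-Reasoning
        same : ∀ k → K ⊆ newBlock k ≡ newBlock k ≐ K
        same k = Bool-ext
          (λ h → ∧-intro (⊆⁺ {P = newBlock k} (⊆-antisym-# (⊆⁻ {P = K} h)
            (≤-reflexive (trans (#-dim (proj₁ (newBlock-props k))) (sym (#-dim extension-dim)))))) h)
          (λ h → ∧-elimʳ {newBlock k ⊆ K} h)
        count : J.# (λ k → newBlock k ≐ K) ≡ χ (avoids K)
        count with true-or-false (avoids K)
        ... | inj₁ a rewrite a = trans (#-newBlock-≐ K) (cong χ (any⁺ (_≐ K) K∈ (≐⁺ {K} (λ _ → refl))))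
          where
          triple : Triple
          triple = x , b Fin.zero , b (Fin.suc Fin.zero)
          K∈ : K ∈ candidates
          K∈ = ∈ₚ.∈-map⁺ (span ∘ vectors) (∈ₚ.∈-filter⁺ (λ t → suitable t Boolₚ.≟ true) (∈-triples triple)
            (∧-intro (independent⁺ triple ind) a))
        ... | inj₂ a rewrite a = trans (J.#-cong {Q = λ _ → false} (λ k → not-true⇒false (λ h → true≢false
              (trans (sym (avoids-cong (≐⁻ {newBlock k} {K} h) (proj₂ (newBlock-props k)))) a)))) (∑-zero J)

    newBlock-balanced : countFin (length newBlocks) (λ k → T ⊆ᵇ newBlock k) ≡ q ^ 4
    newBlock-balanced = trans (sym (∑-tabulate id (λ k → T ⊆ newBlock k)))
      (solve-λ q 1<q (trans (+-comm (N * q ^ 2) G) count-G) count-all count-X)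
      where
      open ≡-Reasoning
      N = J.# (λ k → T ⊆ newBlock k)
      through orthogonals : Vector F d → ℕ
      through     x = ∑ J (λ k → χ (T ⊆ newBlock k) * χ (newBlock k x))
      orthogonals x = ∑ I (λ i → χ (orthogonal dimT i) * χ (perp (block i) x))
      G = ∑ V (λ x → χ (not (T x)) * through x)
      X = ∑ V (λ x → χ (not (T x)) * orthogonals x)
      count-G : G + N * q ^ 2 ≡ N * q ^ 3
      count-G = trans (cong (λ s → G + N * s) (sym (#-dim dimT)))
        (double-count-outside J (λ k → T ⊆ newBlock k) newBlock T (q ^ 3)
          (λ k h → ⊆⁻ {P = T} h , #-dim (proj₁ (newBlock-props k))))
      count-X : X + (q ^ 2 + 1) * q ^ 2 ≡ (q ^ 2 + 1) * q ^ 4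
      count-X = subst₂ (λ n s → X + n * s ≡ n * q ^ 4) (#-orthogonal dimT) (#-dim dimT)
        (double-count-outside I (orthogonal dimT) (perp ∘ block) T (q ^ 4)
          (λ i h → ⊆⁻ {P = T} h , #-perp-dim3 (block-subspace i) (#-block i)))
      -- Every vector is counted exactly once: it lies in T, or ⟨T , x⟩ is a new block, or ⟨T , x⟩
      -- is orthogonal to exactly one old block.
      pointwise : ∀ x → χ (not (T x)) * through x + χ (not (T x)) * orthogonals x + χ (T x) ≡ 1
      pointwise x with true-or-false (T x)
      ... | inj₁ Tx rewrite Tx = refl
      ... | inj₂ Tx rewrite Tx = begin
        1 * through x + 1 * orthogonals x + 0 ≡⟨ trans (+-identityʳ _) (cong₂ _+_ (*-identityˡ (through x)) (*-identityˡ (orthogonals x))) ⟩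
        through x + orthogonals x             ≡⟨ cong₂ _+_ (#-newBlocks-through Tx) (#-orthogonal-extension Tx) ⟩
        _                                     ≡⟨ χ-avoids (extension-dim Tx) ⟩
        1                                     ∎
      count-all : G + X + q ^ 2 ≡ q ^ 7
      count-all = begin
        G + X + q ^ 2  ≡⟨ cong (G + X +_) (sym (#-dim dimT)) ⟩
        G + X + # T    ≡⟨ trans (cong (_+ # T) (sym (∑-+ V _ _))) (sym (∑-+ V _ _)) ⟩
        ∑ V (λ x → χ (not (T x)) * through x + χ (not (T x)) * orthogonals x + χ (T x)) ≡⟨ ∑-cong V pointwise ⟩
        # (full {d})   ≡⟨ #-full₇ ⟩
        q ^ 7          ∎

theorem4p1 : (q : ℕ) → IsPrimePower q → (F : FiniteField q) →
    SubspaceDesign F 2 7 3 1 → SubspaceDesign F 2 7 3 (q ^ 4)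
theorem4p1 q _ F D = record
  { numBlocks = length newBlocks
  ; block     = newBlock
  ; blockDim  = λ k → proj₁ (newBlock-props k)
  ; distinct  = newBlock-distinct
  ; balanced  = λ T dimT → newBlock-balanced dimT
  }
  where open Construction refl F D
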